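{- Let $H$ be a graph that is not isomorphic to any of $K_{1,3}$, $K_{1,3}^+$, $2P_1+P_3$. The class of $H$-free $3$-colourable graphs is ioct-identical if and only if $H$ is (isomorphic to) a (not necessarily induced) subgraph of $P_4$ that is not isomorphic to $2P_2$.
   Context: Graphs are finite, simple and undirected. A graph is $H$-free if it has no induced subgraph isomorphic to $H$. $G+H$ is the disjoint union and $sG$ is the disjoint union of $s$ copies of $G$. $P_n$ is the path on $n$ vertices. $K_{1,3}$ is the star with $3$ leaves, and $K_{1,3}^+$ is the graph obtained from $K_{1,3}$ by subdividing one edge once. A subgraph of a graph is obtained by deleting vertices and/or edges. An odd cycle transversal of $G$ is a set $S\subseteq V(G)$ such that $G-S$ is bipartite; it is independent if $S$ is an independent set. A graph has an independent odd cycle transversal if and only if it is $3$-colourable. For a $3$-colourable graph $G$, $\mathrm{oct}(G)$ is the minimum size of an odd cycle transversal and $\mathrm{ioct}(G)$ is the minimum size of an independent odd cycle transversal. A class $\mathcal X$ of $3$-colourable graphs is ioct-identical if $\mathrm{ioct}(G)=\mathrm{oct}(G)$ for every $G\in\mathcal X$. -}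

module Defs where

open import Data.Bool.Base using (Bool; true; false; T; not; _∧_; _∨_)
open import Data.Bool.Properties using (∨-comm; T?)
open import Data.Empty using (⊥-elim)
open import Data.Fin.Base using (Fin; zero; suc; toℕ; splitAt)
open import Data.Fin.Properties using (_≟_; all?)
open import Data.Fin.Subset using (Subset; inside; outside; _∈_; ∣_∣; ∁)
open import Data.Fin.Subset.Properties
  using (_∈?_; anySubset?; x∈∁p⇒x∉p)
open import Data.Nat.Base using (ℕ; zero; suc; _+_; _*_; _≤_; s≤s⁻¹)
import Data.Nat.Properties as ℕ
open import Data.Product.Base using (_×_; _,_; proj₁; proj₂; Σ-syntax; ∃-syntax)
open import Data.Sum.Base using (_⊎_; inj₁; inj₂)
open import Data.Vec.Base using (_∷_; tabulate; here; there)
open import Data.Vec.Properties using (lookup∘tabulate; lookup⇒[]=; []=⇒lookup)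
open import Function.Base using (_∘_)
open import Function.Bundles using (_↔_; module Inverse)
open import Relation.Binary.PropositionalEquality
  using (_≡_; _≢_; refl; sym; trans; cong; cong₂)
open import Relation.Nullary using (¬_; Dec; yes; no)
open import Relation.Nullary.Decidable
  using (does; dec-true; ¬?; _→-dec_; _×-dec_)
open import Relation.Unary using (Pred; Decidable)
open import Level using (0ℓ)

private
  variable
    m n : ℕ

record Graph (n : ℕ) : Set where
  field
    adj    : Fin n → Fin n → Bool
    symm   : ∀ u v → adj u v ≡ adj v u
    irrefl : ∀ v → adj v v ≡ false

  Adj : Fin n → Fin n → Set
  Adj u v = T (adj u v)

open Graph public

infix 4 _≅_ _⊑_ _⊆ᴳ_

_≅_ : Graph m → Graph n → Set
_≅_ {m} {n} G H =
  Σ[ f ∈ Fin m ↔ Fin n ]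
    (∀ u v → adj G u v ≡ adj H (Inverse.to f u) (Inverse.to f v))

-- The elements of S in increasing order.
elements : (S : Subset n) → Fin ∣ S ∣ → Fin n
elements (inside  ∷ S) zero    = zero
elements (inside  ∷ S) (suc i) = suc (elements S i)
elements (outside ∷ S) i       = suc (elements S i)

elements-∈ : (S : Subset n) (i : Fin ∣ S ∣) → elements S i ∈ S
elements-∈ (inside  ∷ S) zero    = here
elements-∈ (inside  ∷ S) (suc i) = there (elements-∈ S i)
elements-∈ (outside ∷ S) i       = there (elements-∈ S i)

infixl 9 _[_] _∖_

-- The subgraph induced by S, with its vertices renumbered in order.
_[_] : Graph n → (S : Subset n) → Graph ∣ S ∣
adj    (G [ S ]) u v = adj G (elements S u) (elements S v)
symm   (G [ S ]) u v = symm G (elements S u) (elements S v)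
irrefl (G [ S ]) v   = irrefl G (elements S v)

_∖_ : Graph n → (S : Subset n) → Graph ∣ ∁ S ∣
G ∖ S = G [ ∁ S ]

-- F arises from G by deleting edges only.
_⊑_ : Graph n → Graph n → Set
F ⊑ G = ∀ u v → Adj F u v → Adj G u v

-- H is isomorphic to a graph obtained from G by deleting vertices and edges.
_⊆ᴳ_ : Graph m → Graph n → Set
H ⊆ᴳ G = ∃[ S ] Σ[ F ∈ Graph ∣ S ∣ ] (F ⊑ G [ S ] × H ≅ F)

Free : Graph m → Graph n → Set
Free H G = ∀ S → ¬ (G [ S ] ≅ H)

Colourable : ℕ → Graph n → Set
Colourable {n} k G = Σ[ c ∈ (Fin n → Fin k) ] (∀ u v → Adj G u v → c u ≢ c v)

Independent : Graph n → Subset n → Set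
Independent G S = ∀ u v → u ∈ S → v ∈ S → ¬ Adj G u v

Bipartite : Graph n → Set
Bipartite G = ∃[ A ] (Independent G A × Independent G (∁ A))

OddCycleTransversal : Graph n → Subset n → Set
OddCycleTransversal G S = Bipartite (G ∖ S)

IndependentOCT : Graph n → Subset n → Set
IndependentOCT G S = OddCycleTransversal G S × Independent G S

independent? : (G : Graph n) → Decidable (Independent G)
independent? G S = all? λ u → all? λ v →
  u ∈? S →-dec (v ∈? S →-dec ¬? (T? (adj G u v)))

bipartite? : (G : Graph n) → Dec (Bipartite G)
bipartite? G = anySubset? λ A → independent? G A ×-dec independent? G (∁ A)

oddCycleTransversal? : (G : Graph n) → Decidable (OddCycleTransversal G)
oddCycleTransversal? G S = bipartite? (G ∖ S)

independentOCT? : (G : Graph n) → Decidable (IndependentOCT G)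
independentOCT? G S = oddCycleTransversal? G S ×-dec independent? G S

IsMinimumSize : Pred (Subset n) 0ℓ → ℕ → Set
IsMinimumSize P k = (∃[ S ] (P S × ∣ S ∣ ≡ k)) × (∀ S → P S → k ≤ ∣ S ∣)

minimumSize : {P : Pred (Subset n) 0ℓ} → Decidable P →
              (∃[ S ] P S) → ∃[ k ] IsMinimumSize P k
minimumSize {n} {P} P? (S₀ , p₀) = search ∣ S₀ ∣ S₀ p₀ ℕ.≤-refl
  where
  search : ∀ b S → P S → ∣ S ∣ ≤ b → ∃[ k ] IsMinimumSize P k
  search b S p S≤b with anySubset? (λ R → P? R ×-dec (∣ R ∣ ℕ.<? ∣ S ∣))
  ... | no none = ∣ S ∣ , (S , p , refl) , λ R q → ℕ.≮⇒≥ λ R<S → none (R , q , R<S)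
  search zero    S p S≤b | yes (R , q , R<S) = ⊥-elim (ℕ.n≮0 (ℕ.<-≤-trans R<S S≤b))
  search (suc b) S p S≤b | yes (R , q , R<S) =
    search b R q (s≤s⁻¹ (ℕ.<-≤-trans R<S S≤b))

colourClass : {k : ℕ} → (Fin n → Fin k) → Fin k → Subset n
colourClass c i = tabulate λ v → does (c v ≟ i)

∈colourClass⁻ : {k : ℕ} (c : Fin n → Fin k) (i : Fin k) {v : Fin n} →
          v ∈ colourClass c i → c v ≡ i
∈colourClass⁻ c i {v} v∈ with c v ≟ i | trans (sym (lookup∘tabulate _ v)) ([]=⇒lookup v∈)
... | yes eq | _ = eq
... | no  _  | ()

∈colourClass⁺ : {k : ℕ} (c : Fin n → Fin k) (i : Fin k) {v : Fin n} →
          c v ≡ i → v ∈ colourClass c i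
∈colourClass⁺ c i {v} eq =
  lookup⇒[]= v _ (trans (lookup∘tabulate _ v) (dec-true (c v ≟ i) eq))

third : {i : Fin 3} → i ≢ zero → i ≢ suc zero → i ≡ suc (suc zero)
third {zero}         ≢0 ≢1 = ⊥-elim (≢0 refl)
third {suc zero}     ≢0 ≢1 = ⊥-elim (≢1 refl)
third {suc (suc zero)} _ _ = refl

-- A colour class of a 3-colouring is an independent odd cycle transversal.
3-colourable⇒IndependentOCT : (G : Graph n) → Colourable 3 G → ∃[ S ] IndependentOCT G S
3-colourable⇒IndependentOCT {n} G (c , proper) = S , (A , indA , ind∁A) , indS
  where
  S : Subset n
  S = colourClass c zero

  c′ : Fin ∣ ∁ S ∣ → Fin 3
  c′ = c ∘ elements (∁ S)

  A : Subset ∣ ∁ S ∣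
  A = colourClass c′ (suc zero)

  indS : Independent G S
  indS u v u∈ v∈ uv = proper u v uv (trans (∈colourClass⁻ c _ u∈) (sym (∈colourClass⁻ c _ v∈)))

  indA : Independent (G ∖ S) A
  indA u v u∈ v∈ uv = proper _ _ uv (trans (∈colourClass⁻ c′ _ u∈) (sym (∈colourClass⁻ c′ _ v∈)))

  colour2 : ∀ v → v ∈ ∁ A → c′ v ≡ suc (suc zero)
  colour2 v v∈ = third
    (x∈∁p⇒x∉p (elements-∈ (∁ S) v) ∘ ∈colourClass⁺ c zero)
    (x∈∁p⇒x∉p v∈ ∘ ∈colourClass⁺ c′ (suc zero))

  ind∁A : Independent (G ∖ S) (∁ A)
  ind∁A u v u∈ v∈ uv = proper _ _ uv (trans (colour2 u u∈) (sym (colour2 v v∈)))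

3-colourable⇒OCT : (G : Graph n) → Colourable 3 G → ∃[ S ] OddCycleTransversal G S
3-colourable⇒OCT G col with 3-colourable⇒IndependentOCT G col
... | S , oct , _ = S , oct

-- The values of oct and ioct do not depend on the given 3-colouring, which
-- serves only to show that a transversal exists.
oct-minimum : (G : Graph n) → Colourable 3 G →
              ∃[ k ] IsMinimumSize (OddCycleTransversal G) k
oct-minimum G col = minimumSize (oddCycleTransversal? G) (3-colourable⇒OCT G col)

ioct-minimum : (G : Graph n) → Colourable 3 G →
               ∃[ k ] IsMinimumSize (IndependentOCT G) k
ioct-minimum G col = minimumSize (independentOCT? G) (3-colourable⇒IndependentOCT G col)

oct : (G : Graph n) → Colourable 3 G → ℕ
oct G col = proj₁ (oct-minimum G col)

ioct : (G : Graph n) → Colourable 3 G → ℕ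
ioct G col = proj₁ (ioct-minimum G col)

GraphClass : Set₁
GraphClass = ∀ {n} → Graph n → Set

record 3-ColourableClass : Set₁ where
  field
    Member     : GraphClass
    colourable : ∀ {n} (G : Graph n) → Member G → Colourable 3 G

IoctIdentical : 3-ColourableClass → Set
IoctIdentical 𝒳 = ∀ {n} (G : Graph n) (G∈𝒳 : Member G) →
  ioct G (colourable G G∈𝒳) ≡ oct G (colourable G G∈𝒳)
  where open 3-ColourableClass 𝒳

Free3Colourable : Graph m → 3-ColourableClass
Free3Colourable H = record
  { Member     = λ G → Free H G × Colourable 3 G
  ; colourable = λ _ → proj₂
  }

_==_ : Fin n → Fin n → Bool
i == j = does (i ≟ j)

consecutive : ℕ → ℕ → Bool
consecutive i j = does (suc i ℕ.≟ j)

consecutive-irrefl : ∀ i → consecutive i i ≡ false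
consecutive-irrefl zero    = refl
consecutive-irrefl (suc i) = consecutive-irrefl i

path : (n : ℕ) → Graph n
adj    (path n) u v = consecutive (toℕ u) (toℕ v) ∨ consecutive (toℕ v) (toℕ u)
symm   (path n) u v = ∨-comm (consecutive (toℕ u) (toℕ v)) _
irrefl (path n) v   =
  cong₂ _∨_ (consecutive-irrefl (toℕ v)) (consecutive-irrefl (toℕ v))

-- K₁,ₖ with centre zero.
star : (k : ℕ) → Graph (suc k)
adj (star k) zero    zero    = false
adj (star k) zero    (suc _) = true
adj (star k) (suc _) zero    = true
adj (star k) (suc _) (suc _) = false
symm (star k) zero    zero    = refl
symm (star k) zero    (suc _) = refl
symm (star k) (suc _) zero    = refl
symm (star k) (suc _) (suc _) = refl
irrefl (star k) zero    = refl
irrefl (star k) (suc _) = refl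

-- Subdivide the edge uv once; zero is the new vertex.
subdivide : (G : Graph n) (u v : Fin n) → Adj G u v → Graph (suc n)
subdivide {n} G u v _ = record { adj = a ; symm = a-symm ; irrefl = a-irrefl }
  where
  isEnd : Fin n → Bool
  isEnd x = (x == u) ∨ (x == v)

  isEdge : Fin n → Fin n → Bool
  isEdge x y = ((x == u) ∧ (y == v)) ∨ ((y == u) ∧ (x == v))

  a : Fin (suc n) → Fin (suc n) → Bool
  a zero    zero    = false
  a zero    (suc y) = isEnd y
  a (suc x) zero    = isEnd x
  a (suc x) (suc y) = adj G x y ∧ not (isEdge x y)

  a-symm : ∀ x y → a x y ≡ a y x
  a-symm zero    zero    = refl
  a-symm zero    (suc y) = refl
  a-symm (suc x) zero    = refl
  a-symm (suc x) (suc y) =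
    cong₂ _∧_ (symm G x y) (cong not (∨-comm ((x == u) ∧ (y == v)) _))

  a-irrefl : ∀ x → a x x ≡ false
  a-irrefl zero    = refl
  a-irrefl (suc x) = cong (_∧ not (isEdge x x)) (irrefl G x)

infixl 6 _⊕_
infixl 7 _·_

_⊕_ : Graph m → Graph n → Graph (m + n)
_⊕_ {m} {n} G H = record
  { adj    = λ u v → a (splitAt m u) (splitAt m v)
  ; symm   = λ u v → a-symm (splitAt m u) (splitAt m v)
  ; irrefl = λ v → a-irrefl (splitAt m v)
  }
  where
  a : Fin m ⊎ Fin n → Fin m ⊎ Fin n → Bool
  a (inj₁ u) (inj₁ v) = adj G u v
  a (inj₂ u) (inj₂ v) = adj H u v
  a (inj₁ _) (inj₂ _) = false
  a (inj₂ _) (inj₁ _) = false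

  a-symm : ∀ u v → a u v ≡ a v u
  a-symm (inj₁ u) (inj₁ v) = symm G u v
  a-symm (inj₂ u) (inj₂ v) = symm H u v
  a-symm (inj₁ _) (inj₂ _) = refl
  a-symm (inj₂ _) (inj₁ _) = refl

  a-irrefl : ∀ v → a v v ≡ false
  a-irrefl (inj₁ v) = irrefl G v
  a-irrefl (inj₂ v) = irrefl H v

_·_ : (s : ℕ) → Graph n → Graph (s * n)
zero  · G = path 0
suc s · G = G ⊕ s · G

K₁,₃ : Graph 4
K₁,₃ = star 3

K₁,₃⁺ : Graph 5
K₁,₃⁺ = subdivide K₁,₃ zero (suc zero) _

{-# OPTIONS --safe #-}
-- Let G be 3-colourable with an odd cycle transversal S that contains an edge, and suppose every
-- colour class of every 3-colouring has more than ∣ S ∣ vertices. If G has no induced 2P₁ + P₂ or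
-- P₁ + P₃, then some triangle avoids S; if G has no induced 4P₁, counting puts four vertices on one
-- side of the bipartition of G − S. If G has no induced P₄, decomposing it by disjoint unions and
-- joins shows that S even contains an independent odd cycle transversal. Every subgraph of P₄ other
-- than 2P₂ is an induced subgraph of one of these four graphs.
--
-- Conversely, H must be an induced subgraph of three graphs with oct = 2 and ioct = 3. The first
-- has no induced 2P₂, 5P₁, 3P₁ + P₂, P₁ + P₄ or C₅, the second no K₁,₄, K₁,₃ + P₁ or double star, and
-- the third no C₃ or C₄; the induced subgraphs of the first that survive the other two are those
-- allowed by the theorem and the three exceptional graphs.
module Submission where

open import Defs
open import Data.Bool.Base using (Bool; true; false; T; not; _∧_; _∨_)
open import Data.Bool.ListAction using (any)
open import Data.Bool.Properties using (T?; ¬-not; not-¬; ∨-comm) renaming (_≟_ to _≟ᵇ_)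
open import Data.Empty using (⊥)
open import Data.Fin using (#_)
open import Data.Fin.Base using (Fin; zero; suc; toℕ; punchOut)
open import Data.Fin.Patterns
open import Data.Fin.Properties
  using (_≟_; any?; all?; suc-injective; injective⇒≤; punchOut-injective)
open import Data.Fin.Subset using (Subset; inside; outside; _∈_; _∉_; ∣_∣; ∁; _-_; _∪_; ⁅_⁆) renaming (⊥ to ∅)
open import Data.Fin.Subset.Properties
  using (_∈?_; anySubset?; x∈∁p⇒x∉p; x∉p⇒x∈∁p; x∉∁p⇒x∈p; x∈p⇒∣p-x∣<∣p∣; x∈p∧x≢y⇒x∈p-y;
    ∣⊥∣≡0; ∪-identityʳ; p⊆q⇒∣p∣≤∣q∣; p⊆p∪q; q⊆p∪q; x∈⁅x⁆; ∣⁅x⁆∣≡1)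
open import Data.List.Base
  using (List; []; _∷_; length; _++_; filter; cartesianProductWith; allFin)
open import Data.List.Membership.Propositional using (find; lose) renaming (_∈_ to _∈ˡ_; _∉_ to _∉ˡ_)
open import Data.List.Membership.Propositional.Properties
  using (∈-filter⁺; ∈-cartesianProductWith⁺; ∈-allFin)
open import Data.List.Properties using (length-++; filter-notAll)
open import Data.List.Relation.Unary.All as All using (All; []; _∷_)
open import Data.List.Relation.Unary.AllPairs using ([]; _∷_)
open import Data.List.Relation.Unary.Any as Any using (Any; here; there)
open import Data.List.Relation.Unary.Unique.Propositional using (Unique)
open import Data.Nat.Base using (ℕ; zero; suc; _+_; _≤_; _<_; z≤n; s≤s; _<ᵇ_; _≡ᵇ_)
open import Data.Nat.Induction using (<-wellFounded)
open import Data.Product.Base using (_×_; _,_; proj₁; proj₂; Σ-syntax; ∃-syntax)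
open import Data.Sum.Base using (_⊎_; inj₁; inj₂; [_,_]′; map₂)
open import Data.Unit.Base using (tt)
open import Data.Vec.Base using (Vec; []; _∷_; lookup; tabulate; here; there)
open import Data.Vec.Properties using (lookup∘tabulate; lookup⇒[]=; []=⇒lookup)
open import Function.Base using (_∘_; id; case_of_)
open import Function.Bundles using (_⇔_; mk⇔; mk↔ₛ′; module Inverse)
open import Function.Definitions using (Injective)
open import Induction.WellFounded using (Acc; acc)
open import Level using (0ℓ)
open import Relation.Binary.PropositionalEquality
  using (_≡_; _≢_; refl; sym; trans; cong; cong₂; subst; subst₂; ≢-sym)
open import Relation.Nullary using (¬_; Dec; yes; no; does; contradiction)
open import Relation.Nullary.Decidable
  using (True; toWitness; map′; dec-true; dec-false; does-⇔; decidable-stable; ¬?; _×-dec_;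
    _⊎-dec_; _→-dec_)
open import Relation.Unary using (Pred; Decidable)
import Data.List.Membership.DecPropositional as DecMembership
import Data.List.Relation.Unary.All.Properties as All
import Data.List.Relation.Unary.Unique.Propositional.Properties as Unique
import Data.Nat.Properties as ℕ

-- Every class of a 3-colouring is an independent odd cycle transversal, hence the assumption on
-- class sizes. As it covers every 3-colouring, one may first recolour the vertices of a class that
-- lack a neighbour of some other colour: more than `∣ S ∣` vertices of the class still see both
-- other colours. Without `2P₁ + P₂` such a vertex misses at most one vertex of either other class.
-- Without `P₁ + P₃` any two classes are completely joined or matched, and along a matching distinct
-- vertices of a class need distinct vertices of S to destroy their triangles, for which S is too
-- small. For `P₄` the crucial case is a join: three colours leave one side monochromatic. Either
-- this side lies in S, or it has a vertex outside S, and then S meets every edge of the other side,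
-- a disjoint union of complete bipartite graphs, whose edges can be covered by an independent part
-- of S.

private
  variable
    k m n : ℕ

-- Subsets and adjacency

does⇒ : {A : Set} (a? : Dec A) → does a? ≡ true → A
does⇒ (yes a) _ = a

subset : (Fin n → Bool) → Subset n
subset = tabulate

∈subset⁺ : (p : Fin n → Bool) {v : Fin n} → p v ≡ true → v ∈ subset p
∈subset⁺ p {v} eq = lookup⇒[]= v _ (trans (lookup∘tabulate p v) eq)

∈subset⁻ : (p : Fin n → Bool) {v : Fin n} → v ∈ subset p → p v ≡ true
∈subset⁻ p {v} v∈ = trans (sym (lookup∘tabulate p v)) ([]=⇒lookup v∈)

⟪_⟫ : {P : Pred (Fin n) 0ℓ} → Decidable P → Subset n
⟪ P? ⟫ = subset (does ∘ P?)

∈⟪⟫⁺ : {P : Pred (Fin n) 0ℓ} (P? : Decidable P) {v : Fin n} → P v → v ∈ ⟪ P? ⟫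
∈⟪⟫⁺ P? {v} p = ∈subset⁺ (does ∘ P?) (dec-true (P? v) p)

∈⟪⟫⁻ : {P : Pred (Fin n) 0ℓ} (P? : Decidable P) {v : Fin n} → v ∈ ⟪ P? ⟫ → P v
∈⟪⟫⁻ P? {v} v∈ with P? v | ∈subset⁻ (does ∘ P?) v∈
... | yes p | _ = p
... | no  _ | ()

index : {S : Subset n} {v : Fin n} → v ∈ S → Fin ∣ S ∣
index {S = inside  ∷ S} here       = zero
index {S = inside  ∷ S} (there v∈) = suc (index v∈)
index {S = outside ∷ S} (there v∈) = index v∈

elements-index : {S : Subset n} {v : Fin n} (v∈ : v ∈ S) → elements S (index v∈) ≡ v
elements-index {S = inside  ∷ S} here       = refl
elements-index {S = inside  ∷ S} (there v∈) = cong suc (elements-index v∈)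
elements-index {S = outside ∷ S} (there v∈) = cong suc (elements-index v∈)

elements-injective : (S : Subset n) → Injective _≡_ _≡_ (elements S)
elements-injective (inside  ∷ S) {zero}  {zero}  _  = refl
elements-injective (inside  ∷ S) {suc i} {suc j} eq = cong suc (elements-injective S (suc-injective eq))
elements-injective (outside ∷ S)                 eq = elements-injective S (suc-injective eq)

Adj-sym : (G : Graph n) {u v : Fin n} → Adj G u v → Adj G v u
Adj-sym G {u} {v} = subst T (symm G u v)

Adj-irrefl : (G : Graph n) {v : Fin n} → ¬ Adj G v v
Adj-irrefl G {v} = subst T (irrefl G v)

-- Induced embeddings

infix 4 _↪_ _↪?_

record _↪_ (H : Graph m) (G : Graph n) : Set where
  constructor embedding
  field
    to        : Fin m → Fin n
    injective : Injective _≡_ _≡_ to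
    adj-≡     : ∀ u v → adj H u v ≡ adj G (to u) (to v)

open _↪_

↪-trans : {F : Graph k} {G : Graph m} {H : Graph n} → F ↪ G → G ↪ H → F ↪ H
↪-trans (embedding f f-inj f-adj) (embedding g g-inj g-adj) =
  embedding (g ∘ f) (f-inj ∘ g-inj) (λ u v → trans (f-adj u v) (g-adj _ _))

≅⇒↪ : (G : Graph m) (H : Graph n) → G ≅ H → G ↪ H
≅⇒↪ G H (f , f-adj) = embedding φ.to (λ {u} {v} eq → trans (sym (φ.strictlyInverseʳ u))
  (trans (cong φ.from eq) (φ.strictlyInverseʳ v))) f-adj
  where module φ = Inverse f

≅-sym : (G : Graph m) (H : Graph n) → G ≅ H → H ≅ G
≅-sym G H (f , f-adj) = mk↔ₛ′ φ.from φ.to φ.strictlyInverseʳ φ.strictlyInverseˡ ,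
  λ u v → sym (trans (f-adj _ _) (cong₂ (adj H) (φ.strictlyInverseˡ u) (φ.strictlyInverseˡ v)))
  where module φ = Inverse f

[]↪ : (G : Graph n) (S : Subset n) → G [ S ] ↪ G
[]↪ G S = embedding (elements S) (elements-injective S) (λ _ _ → refl)

image : (Fin m → Fin n) → Subset n
image f = ⟪ (λ v → any? λ u → f u ≟ v) ⟫

↪⇒[]≅ : {H : Graph m} {G : Graph n} (e : H ↪ G) → G [ image (to e) ] ≅ H
↪⇒[]≅ {m} {n} {H} {G} (embedding f f-inj f-adj) = mk↔ₛ′ g from g∘from from∘g , λ i j →
  trans (cong₂ (adj G) (sym (f∘g i)) (sym (f∘g j))) (sym (f-adj _ _))
  where
  S = image f

  g : Fin ∣ S ∣ → Fin m
  g i = proj₁ (∈⟪⟫⁻ (λ v → any? λ u → f u ≟ v) (elements-∈ S i))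

  f∘g : ∀ i → f (g i) ≡ elements S i
  f∘g i = proj₂ (∈⟪⟫⁻ (λ v → any? λ u → f u ≟ v) (elements-∈ S i))

  ∈S : ∀ u → f u ∈ S
  ∈S u = ∈⟪⟫⁺ (λ v → any? λ u → f u ≟ v) (u , refl)

  from : Fin m → Fin ∣ S ∣
  from u = index (∈S u)

  g∘from : ∀ u → g (from u) ≡ u
  g∘from u = f-inj (trans (f∘g (from u)) (elements-index (∈S u)))

  from∘g : ∀ i → from (g i) ≡ i
  from∘g i = elements-injective S (trans (elements-index (∈S (g i))) (f∘g i))

Free⇒¬↪ : (H : Graph m) (G : Graph n) → Free H G → ¬ (H ↪ G)
Free⇒¬↪ H G free e = free (image (to e)) (↪⇒[]≅ e)

¬↪⇒Free : (H : Graph m) (G : Graph n) → ¬ (H ↪ G) → Free H G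
¬↪⇒Free H G ¬e S iso = ¬e (↪-trans (≅⇒↪ H (G [ S ]) (≅-sym (G [ S ]) H iso)) ([]↪ G S))

-- If y were missed, punching it out would give an injection into a smaller `Fin`.
Fin-injective⇒surjective : (f : Fin n → Fin n) → Injective _≡_ _≡_ f → ∀ y → ∃[ x ] f x ≡ y
Fin-injective⇒surjective {suc n} f f-inj y with any? (λ x → f x ≟ y)
... | yes hit = hit
... | no miss = contradiction
  (injective⇒≤ {f = λ x → punchOut (avoids x)} (f-inj ∘ punchOut-injective (avoids _) (avoids _)))
  ℕ.1+n≰n
  where
  avoids : ∀ x → y ≢ f x
  avoids x eq = miss (x , sym eq)

↪∧≥⇒≅ : {H : Graph m} {G : Graph n} → H ↪ G → n ≤ m → H ≅ G
↪∧≥⇒≅ {H = H} {G} (embedding f f-inj f-adj) n≤m with ℕ.≤-antisym (injective⇒≤ f-inj) n≤m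
... | refl = mk↔ₛ′ f (proj₁ ∘ onto) (proj₂ ∘ onto) (λ x → f-inj (proj₂ (onto (f x)))) , f-adj
  where onto = Fin-injective⇒surjective f f-inj

deleteZero : Graph (suc m) → Graph m
deleteZero H = record
  { adj    = λ u v → adj H (suc u) (suc v)
  ; symm   = λ u v → symm H (suc u) (suc v)
  ; irrefl = λ v → irrefl H (suc v)
  }

-- The vertices are placed one at a time; P records which images are still
-- compatible with the vertices placed so far.
private
  EmbedsWithin : (Fin m → Fin n → Set) → Graph m → Graph n → Set
  EmbedsWithin P H G = Σ[ e ∈ H ↪ G ] (∀ u → P u (to e u))

  embedsWithin? : {P : Fin m → Fin n → Set} → (∀ u x → Dec (P u x)) →
    (H : Graph m) (G : Graph n) → Dec (EmbedsWithin P H G)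
  embedsWithin? {zero} P? H G = yes (embedding (λ ()) (λ { {()} }) (λ ()) , λ ())
  embedsWithin? {suc m} {n} {P} P? H G = map′ extend restrict (any? λ x →
    P? zero x ×-dec embedsWithin? (λ u y → P? (suc u) y ×-dec (¬? (x ≟ y) ×-dec
      (adj H zero (suc u) ≟ᵇ adj G x y))) (deleteZero H) G)
    where
    P′ : Fin n → Fin m → Fin n → Set
    P′ x u y = P (suc u) y × x ≢ y × adj H zero (suc u) ≡ adj G x y

    extend : (∃[ x ] (P zero x × EmbedsWithin (P′ x) (deleteZero H) G)) → EmbedsWithin P H G
    extend (x , px , embedding f f-inj f-adj , pf) = embedding g g-inj g-adj , pg
      where
      g : Fin (suc m) → Fin n
      g zero    = x
      g (suc u) = f u

      pg : ∀ u → P u (g u)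
      pg zero    = px
      pg (suc u) = proj₁ (pf u)

      g-inj : Injective _≡_ _≡_ g
      g-inj {zero}  {zero}  _  = refl
      g-inj {zero}  {suc v} eq = contradiction eq (proj₁ (proj₂ (pf v)))
      g-inj {suc u} {zero}  eq = contradiction (sym eq) (proj₁ (proj₂ (pf u)))
      g-inj {suc u} {suc v} eq = cong suc (f-inj eq)

      g-adj : ∀ u v → adj H u v ≡ adj G (g u) (g v)
      g-adj zero    zero    = trans (irrefl H zero) (sym (irrefl G x))
      g-adj zero    (suc v) = proj₂ (proj₂ (pf v))
      g-adj (suc u) zero    = trans (symm H (suc u) zero) (trans (proj₂ (proj₂ (pf u))) (symm G x (f u)))
      g-adj (suc u) (suc v) = f-adj u v

    restrict : EmbedsWithin P H G → ∃[ x ] (P zero x × EmbedsWithin (P′ x) (deleteZero H) G)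
    restrict (embedding f f-inj f-adj , pf) = f zero , pf zero ,
      embedding (f ∘ suc) (suc-injective ∘ f-inj) (λ u v → f-adj (suc u) (suc v)) ,
      λ u → pf (suc u) , (λ eq → contradiction (f-inj eq) λ ()) , f-adj zero (suc u)

_↪?_ : (H : Graph m) (G : Graph n) → Dec (H ↪ G)
H ↪? G = map′ proj₁ (λ e → e , λ _ → tt) (embedsWithin? (λ _ _ → yes tt) H G)

embed₄ : (Q : Graph 4) (G : Graph n) {a b c d : Fin n} →
  a ≢ b → a ≢ c → a ≢ d → b ≢ c → b ≢ d → c ≢ d →
  adj Q 0F 1F ≡ adj G a b → adj Q 0F 2F ≡ adj G a c → adj Q 0F 3F ≡ adj G a d →
  adj Q 1F 2F ≡ adj G b c → adj Q 1F 3F ≡ adj G b d → adj Q 2F 3F ≡ adj G c d → Q ↪ G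
embed₄ {n} Q G {a} {b} {c} {d} ab ac ad bc bd cd AB AC AD BC BD CD = embedding f f-inj f-adj
  where
  f : Fin 4 → Fin n
  f 0F = a
  f 1F = b
  f 2F = c
  f 3F = d

  f-inj : Injective _≡_ _≡_ f
  f-inj {0F} {0F} _ = refl
  f-inj {0F} {1F} e = contradiction e ab
  f-inj {0F} {2F} e = contradiction e ac
  f-inj {0F} {3F} e = contradiction e ad
  f-inj {1F} {0F} e = contradiction (sym e) ab
  f-inj {1F} {1F} _ = refl
  f-inj {1F} {2F} e = contradiction e bc
  f-inj {1F} {3F} e = contradiction e bd
  f-inj {2F} {0F} e = contradiction (sym e) ac
  f-inj {2F} {1F} e = contradiction (sym e) bc
  f-inj {2F} {2F} _ = refl
  f-inj {2F} {3F} e = contradiction e cd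
  f-inj {3F} {0F} e = contradiction (sym e) ad
  f-inj {3F} {1F} e = contradiction (sym e) bd
  f-inj {3F} {2F} e = contradiction (sym e) cd
  f-inj {3F} {3F} _ = refl

  loop : ∀ {x y} → adj Q x x ≡ adj G y y
  loop {x} {y} = trans (irrefl Q x) (sym (irrefl G y))

  flip : ∀ {x y x′ y′} → adj Q x y ≡ adj G x′ y′ → adj Q y x ≡ adj G y′ x′
  flip e = trans (symm Q _ _) (trans e (symm G _ _))

  f-adj : ∀ u v → adj Q u v ≡ adj G (f u) (f v)
  f-adj 0F 0F = loop
  f-adj 0F 1F = AB
  f-adj 0F 2F = AC
  f-adj 0F 3F = AD
  f-adj 1F 0F = flip AB
  f-adj 1F 1F = loop
  f-adj 1F 2F = BC
  f-adj 1F 3F = BD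
  f-adj 2F 0F = flip AC
  f-adj 2F 1F = flip BC
  f-adj 2F 2F = loop
  f-adj 2F 3F = CD
  f-adj 3F 0F = flip AD
  f-adj 3F 1F = flip BD
  f-adj 3F 2F = flip CD
  f-adj 3F 3F = loop

-- Odd cycle transversals as partial two-colourings

TwoColours : Graph n → Subset n → (Fin n → Bool) → Set
TwoColours G S d = ∀ u v → u ∉ S → v ∉ S → Adj G u v → d u ≢ d v

OCT⇒TwoColours : (G : Graph n) (S : Subset n) → OddCycleTransversal G S → ∃[ d ] TwoColours G S d
OCT⇒TwoColours {n} G S (A , indA , ind∁A) = d , proper
  where
  d : Fin n → Bool
  d v with v ∈? ∁ S
  ... | yes v∈ = does (index v∈ ∈? A)
  ... | no  _  = false

  proper : TwoColours G S d
  proper u v u∉ v∉ uv eq with u ∈? ∁ S | v ∈? ∁ S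
  ... | no  u∉∁ | _       = u∉ (x∉∁p⇒x∈p u∉∁)
  ... | yes _   | no  v∉∁ = v∉ (x∉∁p⇒x∈p v∉∁)
  ... | yes u∈  | yes v∈  with index u∈ ∈? A | index v∈ ∈? A
  ...   | yes p | yes q = indA _ _ p q (subst₂ (Adj G) (sym (elements-index u∈)) (sym (elements-index v∈)) uv)
  ...   | no  p | no  q = ind∁A _ _ (x∉p⇒x∈∁p p) (x∉p⇒x∈∁p q)
                            (subst₂ (Adj G) (sym (elements-index u∈)) (sym (elements-index v∈)) uv)
  proper u v u∉ v∉ uv () | yes _ | yes _ | yes _ | no _
  proper u v u∉ v∉ uv () | yes _ | yes _ | no _ | yes _

TwoColours⇒OCT : (G : Graph n) (S : Subset n) {d : Fin n → Bool} →
  TwoColours G S d → OddCycleTransversal G S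
TwoColours⇒OCT {n} G S {d} proper = A ,
  (λ u v u∈ v∈ uv → clash u v uv (trans (∈subset⁻ d′ u∈) (sym (∈subset⁻ d′ v∈)))) ,
  (λ u v u∈ v∈ uv → clash u v uv (trans (out u∈) (sym (out v∈))))
  where
  d′ = d ∘ elements (∁ S)
  A = subset d′

  clash : ∀ u v → Adj (G ∖ S) u v → d′ u ≢ d′ v
  clash u v = proper _ _ (x∈∁p⇒x∉p (elements-∈ _ u)) (x∈∁p⇒x∉p (elements-∈ _ v))

  out : ∀ {u} → u ∈ ∁ A → d′ u ≡ false
  out u∈ = ¬-not (x∈∁p⇒x∉p u∈ ∘ ∈subset⁺ d′)

Proper : Graph n → (Fin n → Fin k) → Set
Proper G c = ∀ u v → Adj G u v → c u ≢ c v

third≡ : (i j x y : Fin 3) → i ≢ j → x ≢ i → x ≢ j → y ≢ i → y ≢ j → x ≡ y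
third≡ = toWitness {a? = all? λ i → all? λ j → all? λ x → all? λ y →
  ¬? (i ≟ j) →-dec (¬? (x ≟ i) →-dec (¬? (x ≟ j) →-dec (¬? (y ≟ i) →-dec (¬? (y ≟ j) →-dec x ≟ y))))} tt

another : (i : Fin 3) → ∃[ j ] i ≢ j
another zero    = 1F , λ ()
another (suc _) = 0F , λ ()

-- Outside class i two colours remain; testing for one of them, `j`, is the two-colouring.
colourClass-IndependentOCT : (G : Graph n) {c : Fin n → Fin 3} → Proper G c →
  ∀ i → IndependentOCT G (colourClass c i)
colourClass-IndependentOCT G {c} proper i with another i
... | j , i≢j = TwoColours⇒OCT G (colourClass c i) two ,
  λ u v u∈ v∈ uv → proper u v uv (trans (∈colourClass⁻ c i u∈) (sym (∈colourClass⁻ c i v∈)))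
  where
  two : TwoColours G (colourClass c i) (λ v → does (c v ≟ j))
  two u v u∉ v∉ uv eq with c u ≟ j | c v ≟ j
  ... | yes p | yes q = proper u v uv (trans p (sym q))
  ... | no  p | no  q = proper u v uv (third≡ i j (c u) (c v) i≢j (u∉ ∘ ∈colourClass⁺ c i) p
                                                                (v∉ ∘ ∈colourClass⁺ c i) q)
  two u v u∉ v∉ uv () | yes _ | no _
  two u v u∉ v∉ uv () | no _ | yes _

-- ioct(G) = oct(G), stated without minima.
Costless : Graph n → Set
Costless G = ∀ S → OddCycleTransversal G S → ∃[ R ] (IndependentOCT G R × ∣ R ∣ ≤ ∣ S ∣)

ioct≡oct⇒Costless : (G : Graph n) (col : Colourable 3 G) → ioct G col ≡ oct G col → Costless G
ioct≡oct⇒Costless G col eq S octS with ioct-minimum G col | oct-minimum G col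
... | _ , (R , ioctR , refl) , _ | _ , _ , least = R , ioctR , ℕ.≤-trans (ℕ.≤-reflexive eq) (least S octS)

Costless⇒ioct≡oct : (G : Graph n) (col : Colourable 3 G) → Costless G → ioct G col ≡ oct G col
Costless⇒ioct≡oct G col free with ioct-minimum G col | oct-minimum G col
... | _ , (I , (octI , _) , refl) , leastI | _ , (S , octS , refl) , leastS with free S octS
...   | R , ioctR , R≤S = ℕ.≤-antisym (ℕ.≤-trans (leastI R ioctR) R≤S) (leastS I octI)

-- Counting in finite subsets

length≤∣∣ : {S : Subset n} {xs : List (Fin n)} → Unique xs → All (_∈ S) xs → length xs ≤ ∣ S ∣
length≤∣∣ []           []          = z≤n
length≤∣∣ (x∉ ∷ uniq) (x∈ ∷ xs⊆) = ℕ.<-≤-trans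
  (s≤s (length≤∣∣ uniq (All.zipWith (λ (y∈ , x≢y) → x∈p∧x≢y⇒x∈p-y y∈ (≢-sym x≢y)) (xs⊆ , x∉))))
  (x∈p⇒∣p-x∣<∣p∣ x∈)

∣p∪⁅x⁆∣≤1+∣p∣ : (p : Subset n) (x : Fin n) → ∣ p ∪ ⁅ x ⁆ ∣ ≤ suc ∣ p ∣
∣p∪⁅x⁆∣≤1+∣p∣ (inside  ∷ p) zero    = s≤s (ℕ.≤-trans (ℕ.≤-reflexive (cong ∣_∣ (∪-identityʳ p))) (ℕ.n≤1+n _))
∣p∪⁅x⁆∣≤1+∣p∣ (outside ∷ p) zero    = s≤s (ℕ.≤-reflexive (cong ∣_∣ (∪-identityʳ p)))
∣p∪⁅x⁆∣≤1+∣p∣ (inside  ∷ p) (suc x) = s≤s (∣p∪⁅x⁆∣≤1+∣p∣ p x)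
∣p∪⁅x⁆∣≤1+∣p∣ (outside ∷ p) (suc x) = ∣p∪⁅x⁆∣≤1+∣p∣ p x

-- Greedy choice: each chosen vertex is added to T, which grows by at most one.
pick : ∀ k (V T : Subset n) → ∣ T ∣ + k ≤ ∣ V ∣ →
  ∃[ xs ] (length xs ≡ k × Unique xs × All (λ v → v ∈ V × v ∉ T) xs)
pick zero    V T le = [] , refl , [] , []
pick (suc k) V T le with any? (λ v → v ∈? V ×-dec ¬? (v ∈? T))
... | no none = contradiction
  (ℕ.≤-trans (s≤s (ℕ.m≤m+n ∣ T ∣ k)) (ℕ.≤-trans (ℕ.≤-reflexive (sym (ℕ.+-suc ∣ T ∣ k))) le))
  (ℕ.≤⇒≯ (p⊆q⇒∣p∣≤∣q∣ λ {v} v∈ → decidable-stable (v ∈? T) λ v∉ → none (v , v∈ , v∉)))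
... | yes (v , v∈ , v∉) with pick k V (T ∪ ⁅ v ⁆)
  (ℕ.≤-trans (ℕ.+-monoˡ-≤ k (∣p∪⁅x⁆∣≤1+∣p∣ T v)) (ℕ.≤-trans (ℕ.≤-reflexive (sym (ℕ.+-suc ∣ T ∣ k))) le))
...   | xs , refl , uniq , all = v ∷ xs , refl ,
  All.map (λ (_ , w∉) → λ { refl → w∉ (q⊆p∪q T ⁅ v ⁆ (x∈⁅x⁆ v)) }) all ∷ uniq ,
  (v∈ , v∉) ∷ All.map (λ (w∈ , w∉) → w∈ , w∉ ∘ p⊆p∪q ⁅ v ⁆) all

∉-remove : {S : Subset n} {x y : Fin n} → y ∉ S - x → y ≢ x → y ∉ S
∉-remove y∉ y≢x y∈ = y∉ (x∈p∧x≢y⇒x∈p-y y∈ y≢x)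

-- The partner x of the first vertex is deleted from S; by injectivity no later vertex is related to
-- x.
∣∣≤-injective : (V : Subset m) (S : Subset n) (R : Fin m → Fin n → Set) →
  (∀ {a} → a ∈ V → ∃[ x ] (x ∈ S × R a x)) → (∀ {a a′ x} → R a x → R a′ x → a ≡ a′) → ∣ V ∣ ≤ ∣ S ∣
∣∣≤-injective []            S R total inj = z≤n
∣∣≤-injective (outside ∷ V) S R total inj =
  ∣∣≤-injective V S (R ∘ suc) (total ∘ there) (λ r r′ → suc-injective (inj r r′))
∣∣≤-injective (inside ∷ V)  S R total inj with total here
... | x , x∈ , r = ℕ.≤-<-trans
  (∣∣≤-injective V (S - x) (R ∘ suc) rest (λ r r′ → suc-injective (inj r r′)))
  (x∈p⇒∣p-x∣<∣p∣ x∈)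
  where
  rest : ∀ {a} → a ∈ V → ∃[ y ] (y ∈ S - x × R (suc a) y)
  rest a∈ with total (there a∈)
  ... | y , y∈ , r′ = y , x∈p∧x≢y⇒x∈p-y y∈ (λ { refl → contradiction (inj r r′) λ () }) , r′

-- Reduction to large colour classes

T⇒≡ : ∀ {b} → T b → true ≡ b
T⇒≡ {true} _ = refl

¬T⇒≡ : ∀ {b} → ¬ T b → false ≡ b
¬T⇒≡ {true}  ¬t = contradiction tt ¬t
¬T⇒≡ {false} _  = refl

noTriangle : (G : Graph n) {S : Subset n} {d : Fin n → Bool} → TwoColours G S d →
  ∀ {a b c} → a ∉ S → b ∉ S → c ∉ S → Adj G a b → Adj G b c → ¬ Adj G a c
noTriangle G two a∉ b∉ c∉ ab bc ac = two _ _ a∉ c∉ ac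
  (trans (¬-not (two _ _ a∉ b∉ ab)) (sym (¬-not (≢-sym (two _ _ b∉ c∉ bc)))))

Adj⇒≢ : (G : Graph n) {u v : Fin n} → Adj G u v → u ≢ v
Adj⇒≢ G uv refl = Adj-irrefl G uv

-- If no independent transversal of size at most `∣ S ∣` exists, then S is not independent, so it
-- contains an edge, and no colour class is that small.
costlessUnless : (G : Graph n) →
  (∀ S d → TwoColours G S d → ∀ x y → x ∈ S → y ∈ S → Adj G x y →
   ¬ (∀ {c : Fin n → Fin 3} → Proper G c → ∀ i → ∣ S ∣ < ∣ colourClass c i ∣)) →
  Costless G
costlessUnless G absurd S oct with independent? G S
... | yes ind = S , (oct , ind) , ℕ.≤-refl
... | no ¬ind with anySubset? (λ R → independentOCT? G R ×-dec ∣ R ∣ ℕ.≤? ∣ S ∣)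
...   | yes found = found
...   | no  none with OCT⇒TwoColours G S oct
...     | d , two = contradiction
  (λ x y x∈ y∈ xy → absurd S d two x y x∈ y∈ xy λ {c} proper i →
    ℕ.≰⇒> λ small → none (colourClass c i , colourClass-IndependentOCT G proper i , small))
  ¬ind

remaining : {i j : Fin 3} → i ≢ j → ∃[ l ] (l ≢ i × l ≢ j)
remaining {0F} {1F} _ = 2F , (λ ()) , λ ()
remaining {0F} {2F} _ = 1F , (λ ()) , λ ()
remaining {1F} {0F} _ = 2F , (λ ()) , λ ()
remaining {1F} {2F} _ = 0F , (λ ()) , λ ()
remaining {2F} {0F} _ = 1F , (λ ()) , λ ()
remaining {2F} {1F} _ = 0F , (λ ()) , λ ()
remaining {0F} {0F} ne = contradiction refl ne
remaining {1F} {1F} ne = contradiction refl ne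
remaining {2F} {2F} ne = contradiction refl ne

module _ (G : Graph n) (S : Subset n)
  (large : ∀ {c : Fin n → Fin 3} → Proper G c → ∀ i → ∣ S ∣ < ∣ colourClass c i ∣)
  {c : Fin n → Fin 3} (proper : Proper G c) where

  -- A vertex of colour i that misses another colour in its neighbourhood can be
  -- given that colour; the vertices that keep colour i still outnumber S.
  core : ∀ i → ∃[ V ] (∣ S ∣ < ∣ V ∣ ×
    (∀ {v} → v ∈ V → c v ≡ i × (∀ {j} → j ≢ i → ∃[ w ] (Adj G v w × c w ≡ j))))
  core i = colourClass c′ i , large proper′ i , λ v∈ → kept _ (∈colourClass⁻ c′ i v∈)
    where
    Misses : Fin n → Fin 3 → Set
    Misses v j = j ≢ i × (∀ w → Adj G v w → c w ≢ j)

    misses? : ∀ v → Dec (∃[ j ] Misses v j)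
    misses? v = any? λ j → ¬? (j ≟ i) ×-dec all? λ w → T? (adj G v w) →-dec ¬? (c w ≟ j)

    c′ : Fin n → Fin 3
    c′ v with c v ≟ i | misses? v
    ... | yes _ | yes (j , _) = j
    ... | _     | _           = c v

    -- Recoloured vertices all come from the independent class i, so no two are adjacent; the new
    -- colour of one is absent from its neighbourhood.
    proper′ : Proper G c′
    proper′ u v uv eq with c u ≟ i | misses? u | c v ≟ i | misses? v
    ... | yes p | yes (j , _ , mu) | yes q | _       = proper u v uv (trans p (sym q))
    ... | yes p | yes (j , _ , mu) | no  q | yes _   = mu v uv (sym eq)
    ... | yes p | yes (j , _ , mu) | no  q | no _    = mu v uv (sym eq)
    ... | yes p | no _ | yes q | yes _ = proper u v uv (trans p (sym q))
    ... | no  p | yes _ | yes q | yes (_ , _ , mv) = mv u (Adj-sym G uv) eq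
    ... | no  p | no _  | yes q | yes (_ , _ , mv) = mv u (Adj-sym G uv) eq
    ... | yes _ | no _  | yes _ | no _  = proper u v uv eq
    ... | yes _ | no _  | no _  | yes _ = proper u v uv eq
    ... | yes _ | no _  | no _  | no _  = proper u v uv eq
    ... | no _  | yes _ | yes _ | no _  = proper u v uv eq
    ... | no _  | yes _ | no _  | yes _ = proper u v uv eq
    ... | no _  | yes _ | no _  | no _  = proper u v uv eq
    ... | no _  | no _  | yes _ | no _  = proper u v uv eq
    ... | no _  | no _  | no _  | yes _ = proper u v uv eq
    ... | no _  | no _  | no _  | no _  = proper u v uv eq

    kept : ∀ v → c′ v ≡ i → c v ≡ i × (∀ {j} → j ≢ i → ∃[ w ] (Adj G v w × c w ≡ j))
    kept v eq with c v ≟ i | misses? v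
    ... | yes p | yes (j , j≢i , _) = contradiction eq j≢i
    ... | no ¬p | yes _ = contradiction eq ¬p
    ... | no ¬p | no _  = contradiction eq ¬p
    ... | yes p | no none = p , λ {j} j≢i →
      decidable-stable (any? λ w → T? (adj G v w) ×-dec c w ≟ j) λ no-w →
        none (j , j≢i , λ w vw cw → no-w (w , vw , cw))

filter-split : {A : Set} {P : A → Set} (P? : Decidable P) (xs : List A) →
  length (filter P? xs) + length (filter (¬? ∘ P?) xs) ≡ length xs
filter-split P? []       = refl
filter-split P? (x ∷ xs) with P? x
... | yes _ = cong suc (filter-split P? xs)
... | no  _ = trans (ℕ.+-suc _ _) (cong suc (filter-split P? xs))

-- An edge xy inside S leaves room outside S: S meets the class of x in at most
-- ∣ S ∣ − 1 vertices and a class avoiding both x and y in at most ∣ S ∣ − 2.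
module Pick (G : Graph n) {S : Subset n} {x y : Fin n} (x∈ : x ∈ S) (y∈ : y ∈ S) (xy : Adj G x y)
  (V : Subset n) (big : ∣ S ∣ < ∣ V ∣) where

  two-avoiding : ∀ {z} → z ∈ S → z ∉ V → ∃[ xs ] (length xs ≡ 2 × Unique xs × All (λ v → v ∈ V × v ∉ S) xs)
  two-avoiding {z} z∈ z∉ with pick 2 V (S - z) (ℕ.≤-trans (ℕ.≤-reflexive (ℕ.+-comm _ 2))
    (ℕ.≤-trans (s≤s (x∈p⇒∣p-x∣<∣p∣ z∈)) big))
  ... | xs , len , uniq , all = xs , len , uniq ,
    All.map (λ (v∈ , v∉) → v∈ , ∉-remove v∉ λ { refl → z∉ v∈ }) all

  three-avoiding : x ∉ V → y ∉ V → ∃[ xs ] (length xs ≡ 3 × Unique xs × All (λ v → v ∈ V × v ∉ S) xs)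
  three-avoiding x∉ y∉ with pick 3 V (S - x - y) (ℕ.≤-trans (ℕ.≤-reflexive (ℕ.+-comm _ 3))
    (ℕ.≤-trans (s≤s (s≤s (x∈p⇒∣p-x∣<∣p∣ (x∈p∧x≢y⇒x∈p-y y∈ (≢-sym (Adj⇒≢ G xy))))))
      (ℕ.≤-trans (s≤s (x∈p⇒∣p-x∣<∣p∣ x∈)) big)))
  ... | xs , len , uniq , all = xs , len , uniq ,
    All.map (λ (v∈ , v∉) → v∈ , ∉-remove (∉-remove v∉ λ { refl → y∉ v∈ }) λ { refl → x∉ v∈ }) all

-- Graphs without an induced `4P₁`, `2P₁ + P₂` or `P₁ + P₃`

4P₁-free⇒Costless : (G : Graph n) → Colourable 3 G → ¬ (4 · path 1 ↪ G) → Costless G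
4P₁-free⇒Costless G (c , proper) free = costlessUnless G absurd
  where
  absurd : ∀ S d → TwoColours G S d → ∀ x y → x ∈ S → y ∈ S → Adj G x y →
    ¬ (∀ {c} → Proper G c → ∀ i → ∣ S ∣ < ∣ colourClass c i ∣)
  absurd S d two x y x∈ y∈ xy large with remaining (proper x y xy)
  ... | l , l≢x , l≢y
    with Pick.three-avoiding G x∈ y∈ xy (colourClass c l) (large proper l)
           (l≢x ∘ sym ∘ ∈colourClass⁻ c l) (l≢y ∘ sym ∘ ∈colourClass⁻ c l)
       | Pick.two-avoiding G x∈ y∈ xy (colourClass c (c x)) (large proper (c x))
           y∈ (proper x y xy ∘ sym ∘ ∈colourClass⁻ c (c x))
       | Pick.two-avoiding G x∈ y∈ xy (colourClass c (c y)) (large proper (c y))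
           x∈ (proper x y xy ∘ ∈colourClass⁻ c (c y))
  -- There are 3 + 2 + 2 = 7 vertices outside S, but each side of the two-colouring is independent
  -- and can hold only three.
  ... | ls , ls3 , ls! , lsV | xs , xs2 , xs! , xsV | ys , ys2 , ys! , ysV =
    ℕ.≤⇒≯ (ℕ.+-mono-≤ (atMost3 true side₁) (atMost3 false side₂))
      (ℕ.≤-reflexive (sym (trans (filter-split on? all) len)))
    where
    all = ls ++ (xs ++ ys)

    on? : Decidable (λ v → d v ≡ true)
    on? v = d v ≟ᵇ true

    len : length all ≡ 7
    len = trans (length-++ ls) (cong₂ _+_ ls3 (trans (length-++ xs) (cong₂ _+_ xs2 ys2)))

    coloured : ∀ {i zs} → All (λ v → v ∈ colourClass c i × v ∉ S) zs → All (λ v → c v ≡ i) zs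
    coloured = All.map (∈colourClass⁻ c _ ∘ proj₁)

    disjoint : ∀ {i zs ws} → All (λ v → c v ≡ i) zs → All (λ v → c v ≢ i) ws →
      ∀ {v} → ¬ (v ∈ˡ zs × v ∈ˡ ws)
    disjoint zsi wsi (v∈ , v∈′) = All.lookup wsi v∈′ (All.lookup zsi v∈)

    all! : Unique all
    all! = Unique.++⁺ ls! (Unique.++⁺ xs! ys! (disjoint (coloured xsV)
             (All.map (λ cv eq → proper x y xy (trans (sym eq) cv)) (coloured ysV))))
             (disjoint (coloured lsV) (All.++⁺
               (All.map (λ cv eq → l≢x (trans (sym eq) cv)) (coloured xsV))
               (All.map (λ cv eq → l≢y (trans (sym eq) cv)) (coloured ysV))))

    outsideS : All (_∉ S) all
    outsideS = All.++⁺ (All.map proj₂ lsV) (All.++⁺ (All.map proj₂ xsV) (All.map proj₂ ysV))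

    OnSide : Bool → List (Fin _) → Set
    OnSide b zs = Unique zs × All (_∉ S) zs × All (λ v → d v ≡ b) zs

    side₁ : OnSide true (filter on? all)
    side₁ = Unique.filter⁺ on? all! , All.filter⁺ on? outsideS , All.all-filter on? all

    side₂ : OnSide false (filter (¬? ∘ on?) all)
    side₂ = Unique.filter⁺ (¬? ∘ on?) all! , All.filter⁺ (¬? ∘ on?) outsideS ,
      All.map ¬-not (All.all-filter (¬? ∘ on?) all)

    atMost3 : ∀ b {zs} → OnSide b zs → length zs ≤ 3
    atMost3 b {[]}             _ = z≤n
    atMost3 b {_ ∷ []}         _ = s≤s z≤n
    atMost3 b {_ ∷ _ ∷ []}     _ = s≤s (s≤s z≤n)
    atMost3 b {_ ∷ _ ∷ _ ∷ []} _ = s≤s (s≤s (s≤s z≤n))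
    atMost3 b {p ∷ q ∷ r ∷ s ∷ _}
      ((pq ∷ pr ∷ ps ∷ _) ∷ (qr ∷ qs ∷ _) ∷ (rs ∷ _) ∷ _ , p∉ ∷ q∉ ∷ r∉ ∷ s∉ ∷ _ , pb ∷ qb ∷ rb ∷ sb ∷ _) =
      contradiction (embed₄ (4 · path 1) G pq pr ps qr qs rs
        (apart p∉ q∉ pb qb) (apart p∉ r∉ pb rb) (apart p∉ s∉ pb sb)
        (apart q∉ r∉ qb rb) (apart q∉ s∉ qb sb) (apart r∉ s∉ rb sb)) free
      where
      apart : ∀ {u v} → u ∉ S → v ∉ S → d u ≡ b → d v ≡ b → false ≡ adj G u v
      apart u∉ v∉ ub vb = ¬T⇒≡ λ uv → two _ _ u∉ v∉ uv (trans ub (sym vb))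

2P₁⊕P₂-free⇒Costless : (G : Graph n) → Colourable 3 G → ¬ (2 · path 1 ⊕ path 2 ↪ G) → Costless G
2P₁⊕P₂-free⇒Costless {n} G (c , proper) free = costlessUnless G absurd
  where
  -- Otherwise `u₁`, `u₂` and the edge vw induce `2P₁ + P₂`. So a vertex with some neighbour in
  -- another class misses at most one vertex of that class.
  oneOf : ∀ {v w u₁ u₂} → Adj G v w → c v ≢ c w → c u₁ ≡ c w → c u₂ ≡ c w → u₁ ≢ u₂ →
    Adj G v u₁ ⊎ Adj G v u₂
  oneOf {v} {w} {u₁} {u₂} vw v≢w c₁ c₂ u₁≢u₂ with T? (adj G v u₁) | T? (adj G v u₂)
  ... | yes vu₁ | _       = inj₁ vu₁
  ... | no  _   | yes vu₂ = inj₂ vu₂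
  ... | no ¬vu₁ | no ¬vu₂ = contradiction
    (embed₄ (2 · path 1 ⊕ path 2) G {u₁} {u₂} {v} {w} u₁≢u₂
      (λ { refl → v≢w c₁ }) (λ { refl → ¬vu₁ vw }) (λ { refl → v≢w c₂ }) (λ { refl → ¬vu₂ vw }) (Adj⇒≢ G vw)
      (¬T⇒≡ λ e → proper u₁ u₂ e (trans c₁ (sym c₂)))
      (¬T⇒≡ (¬vu₁ ∘ Adj-sym G)) (¬T⇒≡ λ e → proper u₁ w e c₁)
      (¬T⇒≡ (¬vu₂ ∘ Adj-sym G)) (¬T⇒≡ λ e → proper u₂ w e c₂) (T⇒≡ vw)) free

  absurd : ∀ S d → TwoColours G S d → ∀ x y → x ∈ S → y ∈ S → Adj G x y →
    ¬ (∀ {c} → Proper G c → ∀ i → ∣ S ∣ < ∣ colourClass c i ∣)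
  absurd S d two x y x∈ y∈ xy large with remaining (proper x y xy)
  ... | l , l≢x , l≢y with core G S large proper l | core G S large proper (c x) | core G S large proper (c y)
  ... | L , bigL , inL | X , bigX , inX | Y , bigY , inY
    with Pick.three-avoiding G x∈ y∈ xy L bigL (l≢x ∘ sym ∘ proj₁ ∘ inL) (l≢y ∘ sym ∘ proj₁ ∘ inL)
       | Pick.two-avoiding G x∈ y∈ xy X bigX y∈ (proper x y xy ∘ sym ∘ proj₁ ∘ inX)
       | Pick.two-avoiding G x∈ y∈ xy Y bigY x∈ (proper x y xy ∘ proj₁ ∘ inY)
  ... | p ∷ q ∷ r ∷ [] , _ , (pq ∷ pr ∷ _) ∷ (qr ∷ _) ∷ _ , (p∈ , p∉) ∷ (q∈ , q∉) ∷ (r∈ , r∉) ∷ _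
      | a₁ ∷ a₂ ∷ [] , _ , (a₁≢a₂ ∷ _) ∷ _ , (a₁∈ , a₁∉) ∷ (a₂∈ , a₂∉) ∷ _
      | b ∷ _ , _ , _ , (b∈ , b∉) ∷ _ =
    use (toOneOf inY b∈ (proper x y xy) (proj₁ (inX a₁∈)) (proj₁ (inX a₂∈)) a₁≢a₂)
    where
    toOneOf : ∀ {V i j} → (∀ {v} → v ∈ V → c v ≡ i × (∀ {j} → j ≢ i → ∃[ w ] (Adj G v w × c w ≡ j))) →
      ∀ {v u₁ u₂} → v ∈ V → j ≢ i → c u₁ ≡ j → c u₂ ≡ j → u₁ ≢ u₂ → Adj G v u₁ ⊎ Adj G v u₂
    toOneOf inV v∈ j≢i c₁ c₂ u₁≢u₂ with inV v∈
    ... | cv , nbr with nbr j≢i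
    ...   | w , vw , cw = oneOf vw (λ eq → j≢i (trans (sym cw) (trans (sym eq) cv)))
                            (trans c₁ (sym cw)) (trans c₂ (sym cw)) u₁≢u₂

    -- Each of a and b misses at most one of p, q, r, so one of these three is a common neighbour
    -- and closes a triangle outside S.
    module _ {a} (a∈ : a ∈ X) (a∉ : a ∉ S) (ba : Adj G b a) where
      triangle : ∀ {t} → t ∉ S → Adj G b t → ¬ Adj G a t
      triangle t∉ bt at = noTriangle G two a∉ b∉ t∉ (Adj-sym G ba) bt at

      a-two : ∀ {u₁ u₂} → u₁ ∈ L → u₂ ∈ L → u₁ ≢ u₂ → Adj G a u₁ ⊎ Adj G a u₂
      a-two u₁∈ u₂∈ = toOneOf inX a∈ l≢x (proj₁ (inL u₁∈)) (proj₁ (inL u₂∈))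

      b-two : ∀ {u₁ u₂} → u₁ ∈ L → u₂ ∈ L → u₁ ≢ u₂ → Adj G b u₁ ⊎ Adj G b u₂
      b-two u₁∈ u₂∈ = toOneOf inY b∈ l≢y (proj₁ (inL u₁∈)) (proj₁ (inL u₂∈))

      both : ∀ {s t u} → s ∈ L → t ∈ L → u ∈ L → s ∉ S → t ∉ S → u ∉ S → s ≢ t → s ≢ u → t ≢ u →
        ¬ (Adj G a s × Adj G a t)
      both s∈ t∈ u∈ s∉ t∉ u∉ st su tu (as , at) with b-two s∈ t∈ st
      ... | inj₁ bs = triangle s∉ bs as
      ... | inj₂ bt = triangle t∉ bt at

      done : ⊥
      done with a-two p∈ q∈ pq | a-two p∈ r∈ pr | a-two q∈ r∈ qr
      ... | inj₁ ap | inj₂ ar | _       = both p∈ r∈ q∈ p∉ r∉ q∉ pr pq (≢-sym qr) (ap , ar)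
      ... | inj₂ aq | inj₁ ap | _       = both p∈ q∈ r∈ p∉ q∉ r∉ pq pr qr (ap , aq)
      ... | inj₂ aq | inj₂ ar | _       = both q∈ r∈ p∈ q∉ r∉ p∉ qr (≢-sym pq) (≢-sym pr) (aq , ar)
      ... | inj₁ ap | inj₁ _  | inj₁ aq = both p∈ q∈ r∈ p∉ q∉ r∉ pq pr qr (ap , aq)
      ... | inj₁ ap | inj₁ _  | inj₂ ar = both p∈ r∈ q∈ p∉ r∉ q∉ pr pq (≢-sym qr) (ap , ar)

    use : Adj G b a₁ ⊎ Adj G b a₂ → ⊥
    use (inj₁ ba) = done a₁∈ a₁∉ ba
    use (inj₂ ba) = done a₂∈ a₂∉ ba

P₁⊕P₃-free⇒Costless : (G : Graph n) → Colourable 3 G → ¬ (path 1 ⊕ path 3 ↪ G) → Costless G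
P₁⊕P₃-free⇒Costless {n} G (c , proper) free = costlessUnless G absurd
  where
  forbid : ∀ {z u v w} → Adj G u v → Adj G v w → u ≢ w → ¬ Adj G u w →
    z ≢ u → z ≢ v → z ≢ w → ¬ Adj G z u → ¬ Adj G z v → Adj G z w
  forbid {z} {u} {v} {w} uv vw u≢w ¬uw zu zv zw ¬zu ¬zv = decidable-stable (T? _) λ ¬zw →
    free (embed₄ (path 1 ⊕ path 3) G {z} {u} {v} {w} zu zv zw (Adj⇒≢ G uv) u≢w (Adj⇒≢ G vw)
      (¬T⇒≡ ¬zu) (¬T⇒≡ ¬zv) (¬T⇒≡ ¬zw) (T⇒≡ uv) (¬T⇒≡ ¬uw) (T⇒≡ vw))

  same : ∀ {u v i} → c u ≡ i → c v ≡ i → ¬ Adj G u v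
  same cu cv uv = proper _ _ uv (trans cu (sym cv))

  differ : ∀ {u v i j} → i ≢ j → c u ≡ i → c v ≡ j → u ≢ v
  differ i≢j cu cv refl = i≢j (trans (sym cu) cv)

  -- `Matching i j` bounds by one the number of neighbours of colour i at a vertex of colour j; the
  -- edges form a matching when `Matching j i` holds too.
  Complete Matching : Fin 3 → Fin 3 → Set
  Complete i j = ∀ u v → c u ≡ i → c v ≡ j → Adj G u v
  Matching i j = ∀ {a a′ b} → c a ≡ i → c a′ ≡ i → c b ≡ j → Adj G a b → Adj G a′ b → a ≡ a′

  absurd : ∀ S d → TwoColours G S d → ∀ x y → x ∈ S → y ∈ S → Adj G x y →
    ¬ (∀ {c} → Proper G c → ∀ i → ∣ S ∣ < ∣ colourClass c i ∣)
  absurd S d two x y x∈ y∈ xy large =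
    finish (dichotomy 0F 1F λ ()) (dichotomy 0F 2F λ ()) (dichotomy 1F 2F λ ())
    where
    2≤S : 2 ≤ ∣ S ∣
    2≤S = length≤∣∣ ((Adj⇒≢ G xy ∷ []) ∷ [] ∷ []) (x∈ ∷ y∈ ∷ [])

    -- S contains both x and y, so every class has at least three vertices.
    others : ∀ i v → ∃[ xs ] (length xs ≡ 2 × Unique xs ×
      All (λ w → w ∈ colourClass c i × w ∉ ⁅ v ⁆) xs)
    others i v = pick 2 (colourClass c i) ⁅ v ⁆
      (ℕ.≤-trans (ℕ.≤-reflexive (cong (_+ 2) (∣⁅x⁆∣≡1 v))) (ℕ.≤-trans (s≤s 2≤S) (large proper i)))

    ∉⁅⁆ : ∀ {v w : Fin n} → w ∉ ⁅ v ⁆ → w ≢ v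
    ∉⁅⁆ w∉ refl = w∉ (x∈⁅x⁆ _)

    -- The path a b a′ is an induced `P₃`. Any further vertex of class i is nonadjacent to a and a′,
    -- so it must be adjacent to b.
    completeFrom : ∀ {i j a a′ b} → i ≢ j → c a ≡ i → c a′ ≡ i → c b ≡ j → a ≢ a′ →
      Adj G a b → Adj G a′ b → ∀ {u} → c u ≡ i → Adj G u b
    completeFrom {a = a} {a′} i≢j ca ca′ cb a≢a′ ab a′b {u} cu = decidable-stable (T? _) λ ¬ub →
      same cu ca′ (forbid ab (Adj-sym G a′b) a≢a′ (same ca ca′)
        (λ { refl → ¬ub ab }) (differ i≢j cu cb) (λ { refl → ¬ub a′b }) (same cu ca) ¬ub)

    -- If uv were missing, the induced path u b w would force v to be adjacent to every other vertex
    -- w of class i. Two such w exist, so `completeFrom` applies at v and returns the edge uv.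
    complete : ∀ {i j a a′ b} → i ≢ j → c a ≡ i → c a′ ≡ i → c b ≡ j → a ≢ a′ →
      Adj G a b → Adj G a′ b → Complete i j
    complete {i} {j} {b = b} i≢j ca ca′ cb a≢a′ ab a′b u v cu cv with others i u
    ... | p ∷ q ∷ [] , _ , (p≢q ∷ []) ∷ _ , (p∈ , p∉) ∷ (q∈ , q∉) ∷ [] = decidable-stable (T? _) λ ¬uv →
      let v≢b : v ≢ b
          v≢b = λ { refl → ¬uv (b-full cu) }
          reach : ∀ {w} → c w ≡ i → w ≢ u → Adj G w v
          reach cw w≢u = Adj-sym G (forbid (b-full cu) (Adj-sym G (b-full cw)) (≢-sym w≢u) (same cu cw)
            (≢-sym (differ i≢j cu cv)) v≢b (≢-sym (differ i≢j cw cv)) (¬uv ∘ Adj-sym G) (same cv cb))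
      in ¬uv (completeFrom i≢j cp cq cv p≢q (reach cp (∉⁅⁆ p∉)) (reach cq (∉⁅⁆ q∉)) cu)
      where
      cp = ∈colourClass⁻ c i p∈
      cq = ∈colourClass⁻ c i q∈

      b-full : ∀ {w} → c w ≡ i → Adj G w b
      b-full = completeFrom i≢j ca ca′ cb a≢a′ ab a′b

    Complete-sym : ∀ {i j} → Complete i j → Complete j i
    Complete-sym full u v cu cv = Adj-sym G (full v u cv cu)

    dichotomy : ∀ i j → i ≢ j → Complete i j ⊎ (Matching i j × Matching j i)
    dichotomy i j i≢j with all? (λ u → all? λ v → c u ≟ i →-dec (c v ≟ j →-dec T? (adj G u v)))
    ... | yes full = inj₁ full
    ... | no ¬full = inj₂
      ( (λ {a} {a′} ca ca′ cb ab a′b → decidable-stable (a ≟ a′) λ a≢a′ →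
          ¬full (complete i≢j ca ca′ cb a≢a′ ab a′b))
      , (λ {a} {a′} ca ca′ cb ab a′b → decidable-stable (a ≟ a′) λ a≢a′ →
          ¬full (Complete-sym (complete (≢-sym i≢j) ca ca′ cb a≢a′ ab a′b))) )

    outside-S : ∀ i → ∃[ v ] (c v ≡ i × v ∉ S)
    outside-S i with pick 1 (colourClass c i) S (ℕ.≤-trans (ℕ.≤-reflexive (ℕ.+-comm _ 1)) (large proper i))
    ... | v ∷ [] , _ , _ , (v∈ , v∉) ∷ [] = v , ∈colourClass⁻ c i v∈ , v∉

    -- Under a matching the triangles at the vertices of colour i are disjoint, so
    -- S cannot meet all of them.
    Touches : Fin 3 → Fin n → Fin n → Set
    Touches i a x = c a ≡ i × (a ≡ x ⊎ (Adj G a x × c x ≢ i × Matching i (c x)))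

    touches-injective : ∀ {i a a′ x} → Touches i a x → Touches i a′ x → a ≡ a′
    touches-injective (_ , inj₁ refl)   (_ , inj₁ refl)           = refl
    touches-injective (ca , inj₁ refl)  (_ , inj₂ (_ , cx , _))   = contradiction ca cx
    touches-injective (_ , inj₂ (_ , cx , _)) (ca′ , inj₁ refl)   = contradiction ca′ cx
    touches-injective (ca , inj₂ (ax , _ , match)) (ca′ , inj₂ (a′x , _)) = match ca ca′ refl ax a′x

    -- The vertices of class i that see both other colours outnumber S, while a vertex of S is
    -- touched by at most one vertex.
    untouched : ∀ i → ¬ (∀ {a} → c a ≡ i → (∀ {j} → j ≢ i → ∃[ w ] (Adj G a w × c w ≡ j)) →
      ∃[ x ] (x ∈ S × Touches i a x))
    untouched i touch with core G S large proper i
    ... | V , big , inV = ℕ.<⇒≱ big (∣∣≤-injective V S (Touches i)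
      (λ a∈ → touch (proj₁ (inV a∈)) (proj₂ (inV a∈))) touches-injective)

    module _ {i j l : Fin 3} (i≢j : i ≢ j) (i≢l : i ≢ l) where

      noTwoMatchings : j ≢ l → Matching i j → ¬ Matching i l
      noTwoMatchings j≢l mj ml = untouched i touch
        where
        touch : ∀ {a} → c a ≡ i → (∀ {j} → j ≢ i → ∃[ w ] (Adj G a w × c w ≡ j)) →
          ∃[ x ] (x ∈ S × Touches i a x)
        touch {a} ca nbr with nbr (≢-sym i≢j) | nbr (≢-sym i≢l)
        ... | b , ab , refl | e , ae , refl with a ∈? S | b ∈? S | e ∈? S
        ...   | yes a∈ | _      | _      = a , a∈ , ca , inj₁ refl
        ...   | no _   | yes b∈ | _      = b , b∈ , ca , inj₂ (ab , ≢-sym i≢j , mj)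
        ...   | no _   | no _   | yes e∈ = e , e∈ , ca , inj₂ (ae , ≢-sym i≢l , ml)
        ...   | no a∉  | no b∉  | no e∉  = contradiction ae (noTriangle G two a∉ b∉ e∉ ab be)
          where
          -- Without the edge be, the path b a e is an induced `P₃`. Another vertex a′ of colour i
          -- is nonadjacent to a, and to b by `mj`, so it would be adjacent to e, against `ml`.
          be : Adj G b e
          be with others i a
          ... | a′ ∷ _ , _ , _ , (a′∈ , a′∉) ∷ _ = decidable-stable (T? _) λ ¬be →
            ∉⁅⁆ a′∉ (ml ca′ ca refl (forbid (Adj-sym G ab) ae (λ { refl → j≢l refl }) ¬be
              (differ i≢j ca′ refl) (∉⁅⁆ a′∉) (differ i≢l ca′ refl)
              (λ a′b → ∉⁅⁆ a′∉ (mj ca′ ca refl a′b ab)) (same ca′ ca)) ae)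
            where ca′ = ∈colourClass⁻ c i a′∈

      -- One vertex e of class l outside S turns every edge between classes i and j into a triangle,
      -- so S contains an end of each such edge.
      noOneMatching : Complete i l → Complete j l → ¬ Matching i j
      noOneMatching il jl mj with outside-S l
      ... | e , ce , e∉ = untouched i touch
        where
        touch : ∀ {a} → c a ≡ i → (∀ {j} → j ≢ i → ∃[ w ] (Adj G a w × c w ≡ j)) →
          ∃[ x ] (x ∈ S × Touches i a x)
        touch {a} ca nbr with nbr (≢-sym i≢j)
        ... | b , ab , refl with a ∈? S | b ∈? S
        ...   | yes a∈ | _      = a , a∈ , ca , inj₁ refl
        ...   | no _   | yes b∈ = b , b∈ , ca , inj₂ (ab , ≢-sym i≢j , mj)
        ...   | no a∉  | no b∉  = contradiction (il a e ca ce) (noTriangle G two a∉ b∉ e∉ ab (jl b e refl ce))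

    finish : Complete 0F 1F ⊎ (Matching 0F 1F × Matching 1F 0F) →
             Complete 0F 2F ⊎ (Matching 0F 2F × Matching 2F 0F) →
             Complete 1F 2F ⊎ (Matching 1F 2F × Matching 2F 1F) → ⊥
    -- Two pairs of colours always share a colour; it plays the role of i in `noTwoMatchings`.
    finish (inj₂ (m01 , _)) (inj₂ (m02 , _)) _                = noTwoMatchings (λ ()) (λ ()) (λ ()) m01 m02
    finish (inj₂ (_ , m10)) (inj₁ _)         (inj₂ (m12 , _)) = noTwoMatchings (λ ()) (λ ()) (λ ()) m10 m12
    finish (inj₁ _)         (inj₂ (_ , m20)) (inj₂ (_ , m21)) = noTwoMatchings (λ ()) (λ ()) (λ ()) m20 m21
    finish (inj₂ (m01 , _)) (inj₁ f02)       (inj₁ f12) = noOneMatching (λ ()) (λ ()) f02 f12 m01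
    finish (inj₁ f01)       (inj₂ (m02 , _)) (inj₁ f12) = noOneMatching (λ ()) (λ ()) f01 (Complete-sym f12) m02
    finish (inj₁ f01)       (inj₁ f02)       (inj₂ (m12 , _)) =
      noOneMatching (λ ()) (λ ()) (Complete-sym f01) (Complete-sym f02) m12
    finish (inj₁ f01)       (inj₁ f02)       (inj₁ f12) with outside-S 0F | outside-S 1F | outside-S 2F
    ... | a , ca , a∉ | b , cb , b∉ | e , ce , e∉ =
      noTriangle G two a∉ b∉ e∉ (f01 a b ca cb) (f12 b e cb ce) (f02 a e ca ce)

-- P₄-free graphs: decomposition and recolouring

module P₄-Free (G : Graph n) (free : ¬ (path 4 ↪ G)) where
  open DecMembership (_≟_ {n}) using () renaming (_∈?_ to _∈ˡ?_)

  noP₄ : ∀ {u v w x} → adj G u v ≡ true → adj G v w ≡ true → adj G w x ≡ true →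
    adj G u w ≡ false → adj G v x ≡ false → adj G u x ≡ false → ⊥
  noP₄ {u} {v} {w} {x} uv vw wx uw vx ux = free (embed₄ (path 4) G
    (distinct uv) (λ { refl → clash wx ux }) (λ { refl → clash wx (trans (symm G _ _) uw) })
    (distinct vw) (λ { refl → clash uv ux }) (distinct wx)
    (sym uv) (sym uw) (sym ux) (sym vw) (sym vx) (sym wx))
    where
    clash : ∀ {b} → b ≡ true → b ≡ false → ⊥
    clash refl ()

    distinct : ∀ {a b} → adj G a b ≡ true → a ≢ b
    distinct ab refl = clash ab (irrefl G _)

  -- The class of P₄-free graphs is closed under complementation.
  noP₄-complement : ∀ b {u v w x} → adj G u v ≡ not b → adj G v w ≡ not b → adj G w x ≡ not b →
    adj G u w ≡ b → adj G v x ≡ b → adj G u x ≡ b → ⊥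
  noP₄-complement false uv vw wx uw vx ux = noP₄ uv vw wx uw vx ux
  noP₄-complement true  uv vw wx uw vx ux =
    -- The complement of the path u v w x is the path w u x v.
    noP₄ (flip uw) ux (flip vx) wx uv (flip vw)
    where
    flip : ∀ {a b t} → adj G a b ≡ t → adj G b a ≡ t
    flip = trans (symm G _ _)

  -- A disjoint union if `joined` is false, a join if it is true; as a Boolean it lets
  -- complementation treat both cases at once.
  record Split (xs : List (Fin n)) : Set₁ where
    field
      Part     : Fin n → Set
      part?    : Decidable Part
      inhab    : ∃[ u ] (u ∈ˡ xs × Part u)
      coinhab  : ∃[ v ] (v ∈ˡ xs × ¬ Part v)
      joined   : Bool
      uniform  : ∀ {u v} → u ∈ˡ xs → v ∈ˡ xs → Part u → ¬ Part v → adj G u v ≡ joined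

  open Split

  swap : ∀ {xs} → Split xs → Split xs
  swap s = record
    { Part    = ¬_ ∘ Part s
    ; part?   = ¬? ∘ part? s
    ; inhab   = coinhab s
    ; coinhab = let u , u∈ , pu = inhab s in u , u∈ , λ ¬p → ¬p pu
    ; joined  = joined s
    ; uniform = λ u∈ v∈ ¬pu ¬¬pv → trans (symm G _ _)
        (uniform s v∈ u∈ (decidable-stable (part? s _) ¬¬pv) ¬pu)
    }

  Trivial : List (Fin n) → Set
  Trivial xs = ∀ {u v} → u ∈ˡ xs → v ∈ˡ xs → u ≡ v

  ∈-∷⁻ : ∀ {x u : Fin n} {xs} → u ∈ˡ x ∷ xs → u ≢ x → u ∈ˡ xs
  ∈-∷⁻ (here eq)  u≢x = contradiction eq u≢x
  ∈-∷⁻ (there u∈) _   = u∈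

  -- p and q lie in the same part; a vertex y of the other part with adj x y ≡ not joined
  -- would complete the path q p x y.
  enlarge : ∀ {x xs} → x ∉ˡ xs → (s : Split xs) → ∀ {p q} → p ∈ˡ xs → q ∈ˡ xs → Part s p →
    adj G x p ≡ not (joined s) → adj G x q ≡ joined s → adj G p q ≡ not (joined s) → Split (x ∷ xs)
  enlarge {x} {xs} x∉ s {p} {q} p∈ q∈ Pp xp xq pq = record
    { Part    = λ u → u ≡ x ⊎ Part s u
    ; part?   = λ u → u ≟ x ⊎-dec part? s u
    ; inhab   = x , here refl , inj₁ refl
    ; coinhab = let y , y∈ , ¬Py = coinhab s in
        y , there y∈ , [ (λ { refl → x∉ y∈ }) , ¬Py ]′
    ; joined  = joined s
    ; uniform = uniform′
    }
    where
    Pq : Part s q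
    Pq = decidable-stable (part? s q) λ ¬Pq → not-¬ (uniform s p∈ q∈ Pp ¬Pq) pq

    x-uniform : ∀ {y} → y ∈ˡ xs → ¬ Part s y → adj G x y ≡ joined s
    x-uniform {y} y∈ ¬Py = decidable-stable (adj G x y ≟ᵇ joined s) λ xy≢ →
      noP₄-complement (joined s) (trans (symm G q p) pq) (trans (symm G p x) xp) (¬-not xy≢)
        (trans (symm G q x) xq) (uniform s p∈ y∈ Pp ¬Py) (uniform s q∈ y∈ Pq ¬Py)

    uniform′ : ∀ {u v} → u ∈ˡ x ∷ xs → v ∈ˡ x ∷ xs → u ≡ x ⊎ Part s u → ¬ (v ≡ x ⊎ Part s v) →
      adj G u v ≡ joined s
    uniform′ u∈ (here v≡x)  pu          ¬pv = contradiction (inj₁ v≡x) ¬pv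
    uniform′ u∈ (there v∈) (inj₁ refl) ¬pv = x-uniform v∈ (¬pv ∘ inj₂)
    uniform′ (here refl) (there v∈) (inj₂ pu) ¬pv = x-uniform v∈ (¬pv ∘ inj₂)
    uniform′ (there u∈) (there v∈) (inj₂ pu) ¬pv = uniform s u∈ v∈ pu (¬pv ∘ inj₂)

  module _ {x : Fin n} {xs : List (Fin n)} (b : Bool) where
    Mixed : Fin n → Fin n → Set
    Mixed p q = adj G x p ≡ not b × adj G x q ≡ b × adj G p q ≡ not b

    -- The list is sorted by adjacency to x. Without a mixed pair, the vertices with value b have
    -- value b to all others, x included; if there are none, x alone splits off with value `not b`.
    adjoin : x ∉ˡ xs → ∀ {z} → z ∈ˡ xs → (∀ {p q} → p ∈ˡ xs → q ∈ˡ xs → Mixed p q → Split (x ∷ xs)) → Split (x ∷ xs)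
    adjoin x∉ {z} z∈ mixed
      with Any.any? (λ p → Any.any? (λ q → adj G x p ≟ᵇ not b ×-dec (adj G x q ≟ᵇ b ×-dec adj G p q ≟ᵇ not b)) xs) xs
    ... | yes any with find any
    ...   | p , p∈ , any′ with find any′
    ...     | q , q∈ , m = mixed p∈ q∈ m
    adjoin x∉ {z} z∈ mixed | no none with Any.any? (λ q → adj G x q ≟ᵇ b) xs
    ... | no all-not = record
      { Part    = _≡ x
      ; part?   = _≟ x
      ; inhab   = x , here refl , refl
      ; coinhab = z , there z∈ , λ { refl → x∉ z∈ }
      ; joined  = not b
      ; uniform = λ { _ v∈ refl v≢x → ¬-not λ xv → all-not (lose (∈-∷⁻ v∈ v≢x) xv) }
      }
    ... | yes some with find some
    ...   | q , q∈ , xq = record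
      -- When b is false, x itself satisfies `adj G x x ≡ b` and has to be kept out.
      { Part    = λ u → u ≢ x × adj G x u ≡ b
      ; part?   = λ u → ¬? (u ≟ x) ×-dec adj G x u ≟ᵇ b
      ; inhab   = q , there q∈ , (λ { refl → x∉ q∈ }) , xq
      ; coinhab = x , here refl , λ (x≢x , _) → x≢x refl
      ; joined  = b
      ; uniform = uniform′
      }
      where
      uniform′ : ∀ {u v} → u ∈ˡ x ∷ xs → v ∈ˡ x ∷ xs → u ≢ x × adj G x u ≡ b → ¬ (v ≢ x × adj G x v ≡ b) →
        adj G u v ≡ b
      uniform′ {u} {v} u∈ v∈ (u≢x , xu) ¬pv with v ≟ x
      ... | yes refl = trans (symm G u x) xu
      ... | no  v≢x  = decidable-stable (adj G u v ≟ᵇ b) λ uv≢ →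
        none (lose (∈-∷⁻ v∈ v≢x) (lose (∈-∷⁻ u∈ u≢x)
          (¬-not (λ xv → ¬pv (v≢x , xv)) , xu , trans (symm G v u) (¬-not uv≢))))

  absorb : ∀ {x u : Fin n} {xs} → x ∈ˡ xs → u ∈ˡ x ∷ xs → u ∈ˡ xs
  absorb x∈ (here refl) = x∈
  absorb x∈ (there u∈)  = u∈

  -- A P₄-free graph with at least two vertices is disconnected or has a disconnected complement.
  split : ∀ xs → Trivial xs ⊎ Split xs
  split []       = inj₁ λ ()
  split (x ∷ xs) with x ∈ˡ? xs | split xs
  ... | yes x∈ | inj₁ triv = inj₁ λ u∈ v∈ → triv (absorb x∈ u∈) (absorb x∈ v∈)
  ... | yes x∈ | inj₂ s    = inj₂ record
    { Part = Part s ; part? = part? s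
    ; inhab = let u , u∈ , pu = inhab s in u , there u∈ , pu
    ; coinhab = let u , u∈ , pu = coinhab s in u , there u∈ , pu
    ; joined = joined s ; uniform = λ u∈ v∈ → uniform s (absorb x∈ u∈) (absorb x∈ v∈) }
  split (x ∷ [])     | no x∉ | inj₁ triv = inj₁ λ { (here refl) (here refl) → refl }
  -- All entries of `y ∷ ys` are one vertex, and with `false` a mixed pair would be a loop at it.
  split (x ∷ y ∷ ys) | no x∉ | inj₁ triv = inj₂ (adjoin false x∉ (here refl)
    λ {p} {q} p∈ q∈ (_ , _ , pq) → case triv p∈ q∈ of λ { refl → case trans (sym pq) (irrefl G p) of λ () })
  -- A mixed pair lies on one side of s, and that side can absorb x.
  split (x ∷ xs)     | no x∉ | inj₂ s = inj₂ (adjoin (joined s) x∉ (proj₁ (proj₂ (inhab s))) mixed)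
    where
    mixed : ∀ {p q} → p ∈ˡ xs → q ∈ˡ xs → Mixed {x} {xs} (joined s) p q → Split (x ∷ xs)
    mixed {p} p∈ q∈ (xp , xq , pq) with part? s p
    ... | yes Pp = enlarge x∉ s p∈ q∈ Pp xp xq pq
    ... | no ¬Pp = enlarge x∉ (swap s) p∈ q∈ ¬Pp xp xq pq

  ≡⇒T : ∀ {b} → b ≡ true → T b
  ≡⇒T refl = _

  ¬T⇒≡false : ∀ {b} → ¬ T b → b ≡ false
  ¬T⇒≡false ¬t = sym (¬T⇒≡ ¬t)

  T⇒≡true : ∀ {b} → T b → b ≡ true
  T⇒≡true t = sym (T⇒≡ t)

  module _ {c : Fin n → Fin 3} (proper : Proper G c)
           {S : Subset n} {d : Fin n → Bool} (two : TwoColours G S d) where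

    -- Colour 0 is to become the independent transversal inside S.
    Recolouring : List (Fin n) → Set
    Recolouring xs = Σ[ e ∈ (Fin n → Fin 3) ] ((∀ {u v} → u ∈ˡ xs → v ∈ˡ xs → Adj G u v → e u ≢ e v) ×
                             (∀ {v} → v ∈ˡ xs → e v ≡ 0F → v ∈ S))

    -- Colour i does not occur outside the monochromatic part, so if this part lies in S, it can be
    -- colour 0. Otherwise a vertex t of it outside S forms a triangle with each edge of the rest,
    -- so S meets all those edges.
    recolourJoin : ∀ {xs} (s : Split xs) → joined s ≡ true → ∀ {i} →
      (∀ {u} → u ∈ˡ xs → Part s u → c u ≡ i) → Recolouring xs
    recolourJoin {xs} s j {i} mono
      with Any.any? (λ u → part? s u ×-dec ¬? (u ∈? S)) xs | another i
    ... | no none | k , i≢k = e , (λ {u} {v} _ _ → e-proper u v) , λ {v} v∈ ev → ∈S v∈ (e-zero v ev)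
      where
      e : Fin n → Fin 3
      e v with c v ≟ i | c v ≟ k
      ... | yes _ | _     = 0F
      ... | no  _ | yes _ = 1F
      ... | no  _ | no  _ = 2F

      e-zero : ∀ v → e v ≡ 0F → c v ≡ i
      e-zero v ev with c v ≟ i | c v ≟ k
      ... | yes eq | _ = eq
      e-zero v () | no _ | yes _
      e-zero v () | no _ | no _

      e-proper : ∀ u v → Adj G u v → e u ≢ e v
      e-proper u v uv eq with c u ≟ i | c u ≟ k | c v ≟ i | c v ≟ k
      ... | yes p | _     | yes q | _     = proper u v uv (trans p (sym q))
      ... | no  _ | yes p | no  _ | yes q = proper u v uv (trans p (sym q))
      ... | no  p | no p′ | no  q | no q′ = proper u v uv (third≡ i k _ _ i≢k p p′ q q′)
      e-proper u v uv () | yes _ | _ | no _ | yes _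
      e-proper u v uv () | yes _ | _ | no _ | no _
      e-proper u v uv () | no _ | yes _ | yes _ | _
      e-proper u v uv () | no _ | yes _ | no _ | no _
      e-proper u v uv () | no _ | no _ | yes _ | _
      e-proper u v uv () | no _ | no _ | no _ | yes _

      ∈S : ∀ {v} → v ∈ˡ xs → c v ≡ i → v ∈ S
      ∈S {v} v∈ cv with part? s v
      ... | yes Pv = decidable-stable (v ∈? S) λ v∉ → none (lose v∈ (Pv , v∉))
      ... | no ¬Pv = let a , a∈ , Pa = inhab s in
        contradiction (trans (mono a∈ Pa) (sym cv)) (proper a v (≡⇒T (trans (uniform s a∈ v∈ Pa ¬Pv) j)))
    ... | yes some | k , i≢k = e , e-proper , e-zero
      where
      t = proj₁ (find some)
      t∈ = proj₁ (proj₂ (find some))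
      Pt = proj₁ (proj₂ (proj₂ (find some)))
      t∉S = proj₂ (proj₂ (proj₂ (find some)))

      ≢i : ∀ {v} → v ∈ˡ xs → ¬ Part s v → c v ≢ i
      ≢i v∈ ¬Pv cv = proper t _ (≡⇒T (trans (uniform s t∈ v∈ Pt ¬Pv) j)) (trans (mono t∈ Pt) (sym cv))

      -- The rest of S is a vertex cover of the complement of Part, a disjoint union of complete
      -- bipartite graphs; Near and Far choose from it one side of each of them.
      Near Far : Fin n → Set
      Near r = c r ≡ k × Any (λ l → ¬ Part s l × Adj G r l × l ∉ S) xs
      Far l  = c l ≢ k × l ∈ S × ¬ Any (λ r → ¬ Part s r × Near r × Adj G l r) xs

      near? : Decidable Near
      near? r = c r ≟ k ×-dec Any.any? (λ l → ¬? (part? s l) ×-dec (T? (adj G r l) ×-dec ¬? (l ∈? S))) xs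

      far? : Decidable Far
      far? l = ¬? (c l ≟ k) ×-dec (l ∈? S ×-dec
        ¬? (Any.any? (λ r → ¬? (part? s r) ×-dec (near? r ×-dec T? (adj G l r))) xs))

      chosen? : Decidable (λ v → Near v ⊎ Far v)
      chosen? v = near? v ⊎-dec far? v

      e : Fin n → Fin 3
      e v with part? s v | chosen? v
      ... | yes _ | _     = 2F
      ... | no  _ | yes _ = 0F
      ... | no  _ | no  _ = 1F

      sameSide : ∀ {u v} → u ∈ˡ xs → v ∈ˡ xs → ¬ Part s u → ¬ Part s v → c u ≢ k → c v ≢ k → ¬ Adj G u v
      sameSide u∈ v∈ ¬Pu ¬Pv cu cv uv = proper _ _ uv
        (third≡ i k _ _ i≢k (≢i u∈ ¬Pu) cu (≢i v∈ ¬Pv) cv)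

      -- If l is in S but not `Far`, it has a `Near` neighbour r′, which has a neighbour l′ outside
      -- S. As l′ r′ l r is no induced `P₄`, l′ is adjacent to r, and r is `Near`.
      covered : ∀ {r l} → r ∈ˡ xs → l ∈ˡ xs → ¬ Part s r → ¬ Part s l → c r ≡ k → c l ≢ k → Adj G r l →
        ¬ (Near r ⊎ Far r) → ¬ ¬ (Near l ⊎ Far l)
      covered {r} {l} r∈ l∈ ¬Pr ¬Pl cr cl rl ¬r ¬l with l ∈? S
      ... | no  l∉S = ¬r (inj₁ (cr , lose l∈ (¬Pl , rl , l∉S)))
      ... | yes l∈S with Any.any? (λ r → ¬? (part? s r) ×-dec (near? r ×-dec T? (adj G l r))) xs
      ...   | no none = ¬l (inj₂ (cl , l∈S , none))
      ...   | yes any with find any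
      ...     | r′ , r′∈ , ¬Pr′ , (cr′ , any′) , lr′ with find any′
      ...       | l′ , l′∈ , ¬Pl′ , r′l′ , l′∉S = noP₄
        (T⇒≡true (Adj-sym G r′l′)) (T⇒≡true (Adj-sym G lr′)) (T⇒≡true (Adj-sym G rl))
        (¬T⇒≡false (sameSide l′∈ l∈ ¬Pl′ ¬Pl (λ cl′ → proper _ _ r′l′ (trans cr′ (sym cl′))) cl))
        (¬T⇒≡false λ r′r → proper _ _ r′r (trans cr′ (sym cr)))
        (¬T⇒≡false λ l′r → ¬r (inj₁ (cr , lose l′∈ (¬Pl′ , Adj-sym G l′r , l′∉S))))

      independent : ∀ {u v} → u ∈ˡ xs → v ∈ˡ xs → ¬ Part s u → ¬ Part s v →
        Near u ⊎ Far u → Near v ⊎ Far v → ¬ Adj G u v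
      independent u∈ v∈ ¬Pu ¬Pv (inj₁ (cu , _))         (inj₁ (cv , _))         uv = proper _ _ uv (trans cu (sym cv))
      independent u∈ v∈ ¬Pu ¬Pv (inj₁ nu)               (inj₂ (_ , _ , none))   uv =
        none (lose u∈ (¬Pu , nu , Adj-sym G uv))
      independent u∈ v∈ ¬Pu ¬Pv (inj₂ (_ , _ , none))   (inj₁ nv)               uv = none (lose v∈ (¬Pv , nv , uv))
      independent u∈ v∈ ¬Pu ¬Pv (inj₂ (cu , _))         (inj₂ (cv , _))         uv = sameSide u∈ v∈ ¬Pu ¬Pv cu cv uv

      unchosen : ∀ {u v} → u ∈ˡ xs → v ∈ˡ xs → ¬ Part s u → ¬ Part s v →
        ¬ (Near u ⊎ Far u) → ¬ (Near v ⊎ Far v) → ¬ Adj G u v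
      unchosen {u} {v} u∈ v∈ ¬Pu ¬Pv ¬u ¬v uv with c u ≟ k | c v ≟ k
      ... | yes cu | yes cv = proper u v uv (trans cu (sym cv))
      ... | yes cu | no  cv = covered u∈ v∈ ¬Pu ¬Pv cu cv uv ¬u ¬v
      ... | no  cu | yes cv = covered v∈ u∈ ¬Pv ¬Pu cv cu (Adj-sym G uv) ¬v ¬u
      ... | no  cu | no  cv = sameSide u∈ v∈ ¬Pu ¬Pv cu cv uv

      e-proper : ∀ {u v} → u ∈ˡ xs → v ∈ˡ xs → Adj G u v → e u ≢ e v
      e-proper {u} {v} u∈ v∈ uv eq with part? s u | chosen? u | part? s v | chosen? v
      ... | yes Pu | _     | yes Pv | _     = proper u v uv (trans (mono u∈ Pu) (sym (mono v∈ Pv)))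
      ... | no ¬Pu | yes u′ | no ¬Pv | yes v′ = independent u∈ v∈ ¬Pu ¬Pv u′ v′ uv
      ... | no ¬Pu | no ¬u | no ¬Pv | no ¬v = unchosen u∈ v∈ ¬Pu ¬Pv ¬u ¬v uv
      e-proper u∈ v∈ uv () | yes _ | _ | no _ | yes _
      e-proper u∈ v∈ uv () | yes _ | _ | no _ | no _
      e-proper u∈ v∈ uv () | no _ | yes _ | yes _ | _
      e-proper u∈ v∈ uv () | no _ | no _ | yes _ | _
      e-proper u∈ v∈ uv () | no _ | yes _ | no _ | no _
      e-proper u∈ v∈ uv () | no _ | no _ | no _ | yes _

      e-zero : ∀ {v} → v ∈ˡ xs → e v ≡ 0F → v ∈ S
      e-zero {v} v∈ ev with part? s v | chosen? v
      ... | no _ | yes (inj₂ (_ , v∈S , _)) = v∈S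
      ... | no ¬Pv | yes (inj₁ (_ , any)) = decidable-stable (v ∈? S) λ v∉S →
        let l , l∈ , ¬Pl , vl , l∉S = find any in
        noTriangle G two t∉S v∉S l∉S (≡⇒T (trans (uniform s t∈ v∈ Pt ¬Pv) j)) vl
          (≡⇒T (trans (uniform s t∈ l∈ Pt ¬Pl) j))
      e-zero v∈ () | yes _ | _
      e-zero v∈ () | no _ | no _

    recolourUnion : ∀ {xs} (s : Split xs) → joined s ≡ false →
      Recolouring (filter (part? s) xs) → Recolouring (filter (¬? ∘ part? s) xs) → Recolouring xs
    recolourUnion {xs} s j (e₁ , proper₁ , zero₁) (e₂ , proper₂ , zero₂) = e , e-proper , e-zero
      where
      e : Fin n → Fin 3
      e v with part? s v
      ... | yes _ = e₁ v
      ... | no  _ = e₂ v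

      part⁺ : ∀ {v} → v ∈ˡ xs → Part s v → v ∈ˡ filter (part? s) xs
      part⁺ = ∈-filter⁺ (part? s)

      copart⁺ : ∀ {v} → v ∈ˡ xs → ¬ Part s v → v ∈ˡ filter (¬? ∘ part? s) xs
      copart⁺ = ∈-filter⁺ (¬? ∘ part? s)

      apart : ∀ {u v} → u ∈ˡ xs → v ∈ˡ xs → Part s u → ¬ Part s v → ¬ Adj G u v
      apart u∈ v∈ Pu ¬Pv uv = case trans (sym (T⇒≡true uv)) (trans (uniform s u∈ v∈ Pu ¬Pv) j) of λ ()

      e-proper : ∀ {u v} → u ∈ˡ xs → v ∈ˡ xs → Adj G u v → e u ≢ e v
      e-proper {u} {v} u∈ v∈ uv eq with part? s u | part? s v
      ... | yes Pu | yes Pv = proper₁ (part⁺ u∈ Pu) (part⁺ v∈ Pv) uv eq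
      ... | yes Pu | no ¬Pv = apart u∈ v∈ Pu ¬Pv uv
      ... | no ¬Pu | yes Pv = apart v∈ u∈ Pv ¬Pu (Adj-sym G uv)
      ... | no ¬Pu | no ¬Pv = proper₂ (copart⁺ u∈ ¬Pu) (copart⁺ v∈ ¬Pv) uv eq

      e-zero : ∀ {v} → v ∈ˡ xs → e v ≡ 0F → v ∈ S
      e-zero {v} v∈ ev with part? s v
      ... | yes Pv = zero₁ (part⁺ v∈ Pv) ev
      ... | no ¬Pv = zero₂ (copart⁺ v∈ ¬Pv) ev

    recolour : ∀ xs → Acc _<_ (length xs) → Recolouring xs
    recolour xs (acc rec) with split xs
    ... | inj₁ triv = (λ _ → 1F) , (λ u∈ v∈ uv _ → Adj⇒≢ G uv (triv u∈ v∈)) , λ _ ()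
    ... | inj₂ s with joined s in j
    ...   | false = recolourUnion s j
      (recolour _ (rec (filter-notAll (part? s) xs (let v , v∈ , ¬Pv = coinhab s in lose v∈ ¬Pv))))
      (recolour _ (rec (filter-notAll (¬? ∘ part? s) xs (let u , u∈ , Pu = inhab s in lose u∈ λ ¬Pu → ¬Pu Pu))))
    ...   | true with Any.any? (λ u → part? s u ×-dec ¬? (c u ≟ c (proj₁ (inhab s)))) xs
    ...     | no none = recolourJoin s j λ {u} u∈ Pu →
      decidable-stable (c u ≟ _) λ cu → none (lose u∈ (Pu , cu))
    -- Two colours on one side of a join leave only the third for the other side.
    ...     | yes some = recolourJoin (swap s) j {c (proj₁ (coinhab s))} λ {v} v∈ ¬Pv →
      let a , a∈ , Pa = inhab s
          z , z∈ , ¬Pz = coinhab s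
          a′ , a′∈ , Pa′ , ca′ = find some
          avoids : ∀ {u v} → u ∈ˡ xs → v ∈ˡ xs → Part s u → ¬ Part s v → c v ≢ c u
          avoids u∈ v∈ Pu ¬Pv = proper _ _ (Adj-sym G (≡⇒T (trans (uniform s u∈ v∈ Pu ¬Pv) j)))
      in third≡ (c a) (c a′) (c v) (c z) (≢-sym ca′)
           (avoids a∈ v∈ Pa ¬Pv) (avoids a′∈ v∈ Pa′ ¬Pv) (avoids a∈ z∈ Pa ¬Pz) (avoids a′∈ z∈ Pa′ ¬Pz)

P₄-free⇒Costless : (G : Graph n) → Colourable 3 G → ¬ (path 4 ↪ G) → Costless G
P₄-free⇒Costless G (c , proper) free S oct with OCT⇒TwoColours G S oct
... | d , two with P₄-Free.recolour G free proper two (allFin _) (<-wellFounded _)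
...   | e , e-proper , e-zero = colourClass e 0F ,
  colourClass-IndependentOCT G (λ u v → e-proper (∈-allFin u) (∈-allFin v)) 0F ,
  p⊆q⇒∣p∣≤∣q∣ (e-zero (∈-allFin _) ∘ ∈colourClass⁻ e 0F)

-- Certifying counterexamples by odd cycles

-- The last vertex of the walk is joined to z. The walk from a has an odd number
-- of vertices, so a two-colouring gives both of its ends the same colour.
OddWalk : Graph n → Fin n → List (Fin n) → Set
OddWalk G z []              = ⊥
OddWalk G z (a ∷ [])        = Adj G a z
OddWalk G z (a ∷ b ∷ c∷ws) = Adj G a b × AdjHead c∷ws × OddWalk G z c∷ws
  where
  AdjHead : List _ → Set
  AdjHead []      = ⊥
  AdjHead (c ∷ _) = Adj G b c

OddCycle : Graph n → List (Fin n) → Set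
OddCycle G []         = ⊥
OddCycle G (a ∷ rest) = OddWalk G a (a ∷ rest)

oddWalk? : (G : Graph n) (z : Fin n) (ws : List (Fin n)) → Dec (OddWalk G z ws)
oddWalk? G z []              = no λ ()
oddWalk? G z (a ∷ [])        = T? _
oddWalk? G z (a ∷ b ∷ [])    = no λ ()
oddWalk? G z (a ∷ b ∷ c ∷ ws) = T? _ ×-dec (T? _ ×-dec oddWalk? G z (c ∷ ws))

oddCycle? : (G : Graph n) (ws : List (Fin n)) → Dec (OddCycle G ws)
oddCycle? G []         = no λ ()
oddCycle? G (a ∷ rest) = oddWalk? G a (a ∷ rest)

oddWalk-clash : (G : Graph n) {S : Subset n} {d : Fin n → Bool} → TwoColours G S d →
  ∀ {z} a ws → z ∉ S → All (_∉ S) (a ∷ ws) → OddWalk G z (a ∷ ws) → d a ≢ d z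
oddWalk-clash G two a []           z∉ (a∉ ∷ [])            az             = two a _ a∉ z∉ az
oddWalk-clash G two a (b ∷ c ∷ ws) z∉ (a∉ ∷ b∉ ∷ c∉ ∷ ws∉) (ab , bc , walk) eq =
  oddWalk-clash G two c ws z∉ (c∉ ∷ ws∉) walk
    (trans (sym (trans (¬-not (two a b a∉ b∉ ab)) (sym (¬-not (≢-sym (two b c b∉ c∉ bc)))))) eq)

oddCycle-clash : (G : Graph n) {S : Subset n} {d : Fin n → Bool} → TwoColours G S d →
  ∀ ws → OddCycle G ws → ¬ All (_∉ S) ws
oddCycle-clash G two (a ∷ ws) cyc ws∉@(a∉ ∷ _) = oddWalk-clash G two a ws a∉ ws∉ cyc refl

atMostTwo : (S : Subset (suc n)) → ∣ S ∣ ≤ 2 →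
  ∃[ u ] ∃[ v ] ((u ≡ v ⊎ (u ∈ S × v ∈ S)) × (∀ {x} → x ∈ S → x ≡ u ⊎ x ≡ v))
atMostTwo S S≤2 with any? (_∈? S)
-- The empty set lies in any pair, so a default vertex will do.
... | no none = zero , zero , inj₁ refl , λ x∈ → contradiction (_ , x∈) none
... | yes (u , u∈) with any? (λ v → v ∈? S ×-dec ¬? (u ≟ v))
...   | no  none = u , u , inj₁ refl , only
  where
  only : ∀ {x} → x ∈ S → x ≡ u ⊎ x ≡ u
  only {x} x∈ with u ≟ x
  ... | yes eq = inj₁ (sym eq)
  ... | no  ne = contradiction (x , x∈ , ne) none
...   | yes (v , v∈ , u≢v) = u , v , inj₂ (u∈ , v∈) , only
  where
  only : ∀ {x} → x ∈ S → x ≡ u ⊎ x ≡ v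
  only {x} x∈ with u ≟ x | v ≟ x
  ... | yes eq | _      = inj₁ (sym eq)
  ... | no  _  | yes eq = inj₂ (sym eq)
  ... | no  u≢ | no v≢  = contradiction
    (ℕ.≤-trans (length≤∣∣ ((u≢v ∷ u≢ ∷ []) ∷ (v≢ ∷ []) ∷ [] ∷ []) (u∈ ∷ v∈ ∷ x∈ ∷ [])) S≤2) ℕ.1+n≰n

Missed : Graph n → Fin n → Fin n → List (Fin n) → Set
Missed G u v ws = OddCycle G ws × All (λ x → x ≢ u × x ≢ v) ws

-- The first two vertices are a transversal. An independent one of at most two vertices would lie in
-- a pair u, v that meets every listed cycle and is therefore an edge: impossible if u = v, and
-- against independence otherwise.
¬Costless : (G : Graph (2 + n)) {d : Fin (2 + n) → Bool} → TwoColours G (inside ∷ inside ∷ ∅) d →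
  (cycles : List (List (Fin (2 + n)))) → (∀ u v → Adj G u v ⊎ Any (Missed G u v) cycles) →
  ¬ Costless G
¬Costless {n} G two cycles missed costless
  with costless (inside ∷ inside ∷ ∅) (TwoColours⇒OCT G (inside ∷ inside ∷ ∅) two)
... | R , (octR , indR) , R≤S with OCT⇒TwoColours G R octR
...   | _ , twoR with atMostTwo R (subst (λ s → ∣ R ∣ ≤ 2 + s) (∣⊥∣≡0 n) R≤S)
...     | u , v , here? , only with missed u v
...       | inj₂ miss with Any.satisfied miss
...         | ws , cyc , avoids = oddCycle-clash G twoR ws cyc (All.map
              (λ (≢u , ≢v) x∈ → [ ≢u , ≢v ]′ (only x∈)) avoids)
¬Costless G two cycles missed costless
    | R , (octR , indR) , R≤S | _ , twoR | u , v , inj₁ refl , only | inj₁ uv = Adj-irrefl G uv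
¬Costless G two cycles missed costless
    | R , (octR , indR) , R≤S | _ , twoR | u , v , inj₂ (u∈ , v∈) , only | inj₁ uv = indR u v u∈ v∈ uv

<ᵇ-irrefl : ∀ a → (a <ᵇ a) ≡ false
<ᵇ-irrefl zero    = refl
<ᵇ-irrefl (suc a) = <ᵇ-irrefl a

-- Row u lists the neighbours of u that are larger than u.
fromRows : Vec (List ℕ) n → Graph n
fromRows {n} rows = record
  { adj    = λ u v → forward u v ∨ forward v u
  ; symm   = λ u v → ∨-comm (forward u v) (forward v u)
  ; irrefl = λ v → cong₂ _∨_ (forward-irrefl v) (forward-irrefl v)
  }
  where
  forward : Fin n → Fin n → Bool
  forward u v = (toℕ u <ᵇ toℕ v) ∧ any (toℕ v ≡ᵇ_) (lookup rows u)

  forward-irrefl : ∀ v → forward v v ≡ false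
  forward-irrefl v = cong (_∧ any (toℕ v ≡ᵇ_) (lookup rows v)) (<ᵇ-irrefl (toℕ v))

proper? : (G : Graph n) (c : Fin n → Fin k) → Dec (Proper G c)
proper? G c = all? λ u → all? λ v → T? (adj G u v) →-dec ¬? (c u ≟ c v)

twoColours? : (G : Graph n) (S : Subset n) (d : Fin n → Bool) → Dec (TwoColours G S d)
twoColours? G S d = all? λ u → all? λ v →
  ¬? (u ∈? S) →-dec (¬? (v ∈? S) →-dec (T? (adj G u v) →-dec ¬? (d u ≟ᵇ d v)))

missed? : (G : Graph n) (cycles : List (List (Fin n))) →
  Dec (∀ u v → Adj G u v ⊎ Any (Missed G u v) cycles)
missed? G cycles = all? λ u → all? λ v → T? (adj G u v) ⊎-dec
  Any.any? (λ ws → oddCycle? G ws ×-dec All.all? (λ x → ¬? (x ≟ u) ×-dec ¬? (x ≟ v)) ws) cycles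

record Counterexample : Set where
  constructor counterexample
  field
    {order}    : ℕ
    graph      : Graph (2 + order)
    colours    : Vec (Fin 3) (2 + order)
    sides      : Vec Bool (2 + order)
    cycles     : List (List (Fin (2 + order)))
    {proper}   : True (proper? graph (lookup colours))
    {twoSides} : True (twoColours? graph (inside ∷ inside ∷ ∅) (lookup sides))
    {missed}   : True (missed? graph cycles)

open Counterexample

counterexample-↪ : (H : Graph m) → IoctIdentical (Free3Colourable H) → (E : Counterexample) → H ↪ graph E
counterexample-↪ H identical E = decidable-stable (H ↪? graph E) λ ¬e →
  ¬Costless (graph E) (toWitness (twoSides E)) (cycles E) (toWitness (missed E))
    (ioct≡oct⇒Costless (graph E) col (identical (graph E) (¬↪⇒Free H (graph E) ¬e , col)))
  where
  col : Colourable 3 (graph E)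
  col = lookup (colours E) , toWitness (proper E)

-- The pairs of vertices meeting all listed cycles are 01 and 13 in `G₁` and only 01 in `G₂` and
-- `G₃`; all are edges. `G₃` is the edge 01 with two 5-cycles attached at each end.
G₁ G₂ G₃ : Counterexample
G₁ = counterexample
  (fromRows ((1 ∷ 3 ∷ 6 ∷ 7 ∷ []) ∷ (2 ∷ 3 ∷ 4 ∷ 5 ∷ 8 ∷ []) ∷ (3 ∷ 5 ∷ 8 ∷ []) ∷ (4 ∷ 6 ∷ 7 ∷ []) ∷
             (5 ∷ 8 ∷ []) ∷ (6 ∷ 7 ∷ []) ∷ (8 ∷ []) ∷ (8 ∷ []) ∷ [] ∷ []))
  (0F ∷ 1F ∷ 0F ∷ 2F ∷ 0F ∷ 2F ∷ 1F ∷ 1F ∷ 2F ∷ [])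
  (false ∷ false ∷ false ∷ true ∷ false ∷ true ∷ false ∷ false ∷ true ∷ [])
  ((0F ∷ 3F ∷ 6F ∷ []) ∷ (0F ∷ 3F ∷ 7F ∷ []) ∷ (1F ∷ 2F ∷ 5F ∷ []) ∷ (1F ∷ 4F ∷ 8F ∷ []) ∷ [])
G₂ = counterexample
  (fromRows ((1 ∷ 3 ∷ 4 ∷ 7 ∷ 8 ∷ []) ∷ (2 ∷ 3 ∷ 5 ∷ 7 ∷ []) ∷ (5 ∷ 6 ∷ []) ∷ (8 ∷ []) ∷
             (7 ∷ []) ∷ (7 ∷ []) ∷ (8 ∷ []) ∷ [] ∷ [] ∷ []))
  (0F ∷ 1F ∷ 2F ∷ 2F ∷ 1F ∷ 0F ∷ 0F ∷ 2F ∷ 1F ∷ [])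
  (false ∷ false ∷ false ∷ true ∷ true ∷ true ∷ true ∷ false ∷ false ∷ [])
  ((0F ∷ 3F ∷ 8F ∷ []) ∷ (0F ∷ 4F ∷ 7F ∷ []) ∷ (1F ∷ 2F ∷ 5F ∷ []) ∷ (1F ∷ 5F ∷ 7F ∷ []) ∷
   (1F ∷ 2F ∷ 6F ∷ 8F ∷ 3F ∷ []) ∷ [])
G₃ = counterexample
  (fromRows ((1 ∷ 2 ∷ 5 ∷ 6 ∷ 9 ∷ []) ∷ (10 ∷ 13 ∷ 14 ∷ 17 ∷ []) ∷
             (3 ∷ []) ∷ (4 ∷ []) ∷ (5 ∷ []) ∷ [] ∷ (7 ∷ []) ∷ (8 ∷ []) ∷ (9 ∷ []) ∷ [] ∷
             (11 ∷ []) ∷ (12 ∷ []) ∷ (13 ∷ []) ∷ [] ∷ (15 ∷ []) ∷ (16 ∷ []) ∷ (17 ∷ []) ∷ [] ∷ []))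
  (0F ∷ 1F ∷ 1F ∷ 0F ∷ 1F ∷ 2F ∷ 1F ∷ 0F ∷ 1F ∷ 2F ∷ 0F ∷ 1F ∷ 0F ∷ 2F ∷ 0F ∷ 1F ∷ 0F ∷ 2F ∷ [])
  (false ∷ false ∷ true ∷ false ∷ true ∷ false ∷ true ∷ false ∷ true ∷ false ∷
   true ∷ false ∷ true ∷ false ∷ true ∷ false ∷ true ∷ false ∷ [])
  ((# 0 ∷ # 2 ∷ # 3 ∷ # 4 ∷ # 5 ∷ []) ∷ (# 0 ∷ # 6 ∷ # 7 ∷ # 8 ∷ # 9 ∷ []) ∷
   (# 1 ∷ # 10 ∷ # 11 ∷ # 12 ∷ # 13 ∷ []) ∷ (# 1 ∷ # 14 ∷ # 15 ∷ # 16 ∷ # 17 ∷ []) ∷ [])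

-- Common induced subgraphs of the counterexamples

C₃ : Graph 3
C₃ = fromRows ((1 ∷ 2 ∷ []) ∷ (2 ∷ []) ∷ [] ∷ [])

C₄ : Graph 4
C₄ = fromRows ((1 ∷ 3 ∷ []) ∷ (2 ∷ []) ∷ (3 ∷ []) ∷ [] ∷ [])

doubleStar : Graph 6
doubleStar = fromRows ((1 ∷ 2 ∷ 3 ∷ []) ∷ (4 ∷ 5 ∷ []) ∷ [] ∷ [] ∷ [] ∷ [] ∷ [])

C₃↪̸G₃ : ¬ (C₃ ↪ graph G₃)
C₃↪̸G₃ = toWitness {a? = ¬? (C₃ ↪? graph G₃)} tt

C₄↪̸G₃ : ¬ (C₄ ↪ graph G₃)
C₄↪̸G₃ = toWitness {a? = ¬? (C₄ ↪? graph G₃)} tt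

K₁,₄↪̸G₂ : ¬ (star 4 ↪ graph G₂)
K₁,₄↪̸G₂ = toWitness {a? = ¬? (star 4 ↪? graph G₂)} tt

K₁,₃⊕P₁↪̸G₂ : ¬ (K₁,₃ ⊕ path 1 ↪ graph G₂)
K₁,₃⊕P₁↪̸G₂ = toWitness {a? = ¬? (K₁,₃ ⊕ path 1 ↪? graph G₂)} tt

doubleStar↪̸G₂ : ¬ (doubleStar ↪ graph G₂)
doubleStar↪̸G₂ = toWitness {a? = ¬? (doubleStar ↪? graph G₂)} tt

4P₁ 2P₁⊕P₂ P₁⊕P₃ P₄ : Graph 4
4P₁    = 4 · path 1
2P₁⊕P₂ = 2 · path 1 ⊕ path 2
P₁⊕P₃  = path 1 ⊕ path 3
P₄     = path 4

-- The maximal H allowed by the theorem, as induced subgraphs.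
allowed : List (Graph 4)
allowed = 4P₁ ∷ 2P₁⊕P₂ ∷ P₁⊕P₃ ∷ P₄ ∷ []

Allowed : Graph n → Set
Allowed H = Any (H ↪_) allowed

allowed? : (H : Graph n) → Dec (Allowed H)
allowed? H = Any.any? (H ↪?_) allowed

2P₁⊕P₃ : Graph 5
2P₁⊕P₃ = 2 · path 1 ⊕ path 3

Forbidden : Graph n → Set
Forbidden H = C₃ ↪ H ⊎ C₄ ↪ H ⊎ star 4 ↪ H ⊎ K₁,₃ ⊕ path 1 ↪ H ⊎ doubleStar ↪ H

forbidden? : (H : Graph n) → Dec (Forbidden H)
forbidden? H = C₃ ↪? H ⊎-dec (C₄ ↪? H ⊎-dec (star 4 ↪? H ⊎-dec (K₁,₃ ⊕ path 1 ↪? H ⊎-dec doubleStar ↪? H)))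

-- An embedding into a graph with no more vertices is an isomorphism, so the size bounds single out
-- the exceptional graphs themselves.
Exceptional : Graph n → Set
Exceptional {n} H = (H ↪ K₁,₃ × 4 ≤ n) ⊎ (H ↪ K₁,₃⁺ × 5 ≤ n) ⊎ (H ↪ 2P₁⊕P₃ × 5 ≤ n)

exceptional? : (H : Graph n) → Dec (Exceptional H)
exceptional? {n} H = (H ↪? K₁,₃ ×-dec 4 ℕ.≤? n) ⊎-dec
  ((H ↪? K₁,₃⁺ ×-dec 5 ℕ.≤? n) ⊎-dec (H ↪? 2P₁⊕P₃ ×-dec 5 ℕ.≤? n))

Forbidden-mono : {F : Graph m} {H : Graph n} → F ↪ H → Forbidden F → Forbidden H
Forbidden-mono e (inj₁ f)                      = inj₁ (↪-trans f e)
Forbidden-mono e (inj₂ (inj₁ f))               = inj₂ (inj₁ (↪-trans f e))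
Forbidden-mono e (inj₂ (inj₂ (inj₁ f)))        = inj₂ (inj₂ (inj₁ (↪-trans f e)))
Forbidden-mono e (inj₂ (inj₂ (inj₂ (inj₁ f)))) = inj₂ (inj₂ (inj₂ (inj₁ (↪-trans f e))))
Forbidden-mono e (inj₂ (inj₂ (inj₂ (inj₂ f)))) = inj₂ (inj₂ (inj₂ (inj₂ (↪-trans f e))))

deleteZero-[]↪ : (G : Graph (suc n)) (s : Bool) (S : Subset n) → deleteZero G [ S ] ↪ G [ s ∷ S ]
deleteZero-[]↪ G true  S = embedding suc suc-injective (λ _ _ → refl)
deleteZero-[]↪ G false S = embedding id id (λ _ _ → refl)

-- Pruning the subsets vertex by vertex keeps the enumeration small.
survivors : Graph n → List (Subset n)
survivors {zero}  G = [] ∷ []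
survivors {suc n} G = filter (λ S → ¬? (forbidden? (G [ S ])))
  (cartesianProductWith _∷_ (inside ∷ outside ∷ []) (survivors (deleteZero G)))

-- Pruning is sound because `Forbidden` passes from an induced subgraph to the larger graph.
∈survivors : (G : Graph n) (S : Subset n) → Forbidden (G [ S ]) ⊎ S ∈ˡ survivors G
∈survivors G []      = inj₂ (here refl)
∈survivors G (s ∷ S) = [ inj₁ ∘ Forbidden-mono (deleteZero-[]↪ G s S) , keep (forbidden? (G [ s ∷ S ])) ]′
  (∈survivors (deleteZero G) S)
  where
  ∈bools : ∀ s → s ∈ˡ (inside ∷ outside ∷ [])
  ∈bools true  = here refl
  ∈bools false = there (here refl)

  keep : Dec (Forbidden (G [ s ∷ S ])) → S ∈ˡ survivors (deleteZero G) → Forbidden (G [ s ∷ S ]) ⊎ s ∷ S ∈ˡ survivors G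
  keep (yes f) _  = inj₁ f
  keep (no ¬f) S∈ = inj₂ (∈-filter⁺ (λ S → ¬? (forbidden? (G [ S ])))
    (∈-cartesianProductWith⁺ _∷_ (∈bools s) S∈) ¬f)

survivors⇒all : (G : Graph n) {P : Subset n → Set} → All P (survivors G) →
  (S : Subset n) → Forbidden (G [ S ]) ⊎ P S
survivors⇒all G all S = map₂ (All.lookup all) (∈survivors G S)

Classified : Subset 9 → Set
Classified S = Allowed (graph G₁ [ S ]) ⊎ Exceptional (graph G₁ [ S ])

classified? : Decidable Classified
classified? S = allowed? (graph G₁ [ S ]) ⊎-dec exceptional? (graph G₁ [ S ])

abstract
  survivors-G₁ : All Classified (survivors (graph G₁))
  survivors-G₁ = does⇒ (All.all? classified? (survivors (graph G₁))) refl

G₁-subgraphs : (S : Subset 9) → Forbidden (graph G₁ [ S ]) ⊎ Classified S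
G₁-subgraphs = survivors⇒all (graph G₁) survivors-G₁

-- In use, F is the copy of H inside `G₁`, for which the alternatives were computed; the two
-- embeddings carry the result over to H.
classify : (F : Graph m) (H : Graph n) → F ↪ H → H ↪ F →
  ¬ (H ≅ K₁,₃) → ¬ (H ≅ K₁,₃⁺) → ¬ (H ≅ 2P₁⊕P₃) → H ↪ graph G₂ → H ↪ graph G₃ →
  Forbidden F ⊎ Allowed F ⊎ Exceptional F → Allowed H
classify {m} {n} F H F↪H H↪F ≇K₁,₃ ≇K₁,₃⁺ ≇2P₁⊕P₃ H↪G₂ H↪G₃ = from
  where
  F↪G₂ : F ↪ graph G₂
  F↪G₂ = ↪-trans F↪H H↪G₂

  F↪G₃ : F ↪ graph G₃
  F↪G₃ = ↪-trans F↪H H↪G₃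

  grow : ∀ {k} → k ≤ m → k ≤ n
  grow k≤m = ℕ.≤-trans k≤m (injective⇒≤ (_↪_.injective F↪H))

  from : Forbidden F ⊎ Allowed F ⊎ Exceptional F → Allowed H
  from (inj₁ (inj₁ e))                           = contradiction (↪-trans e F↪G₃) C₃↪̸G₃
  from (inj₁ (inj₂ (inj₁ e)))                    = contradiction (↪-trans e F↪G₃) C₄↪̸G₃
  from (inj₁ (inj₂ (inj₂ (inj₁ e))))             = contradiction (↪-trans e F↪G₂) K₁,₄↪̸G₂
  from (inj₁ (inj₂ (inj₂ (inj₂ (inj₁ e)))))      = contradiction (↪-trans e F↪G₂) K₁,₃⊕P₁↪̸G₂
  from (inj₁ (inj₂ (inj₂ (inj₂ (inj₂ e)))))      = contradiction (↪-trans e F↪G₂) doubleStar↪̸G₂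
  from (inj₂ (inj₁ F-allowed))                   = Any.map (↪-trans H↪F) F-allowed
  from (inj₂ (inj₂ (inj₁ (e , 4≤m))))            = contradiction (↪∧≥⇒≅ (↪-trans H↪F e) (grow 4≤m)) ≇K₁,₃
  from (inj₂ (inj₂ (inj₂ (inj₁ (e , 5≤m)))))     = contradiction (↪∧≥⇒≅ (↪-trans H↪F e) (grow 5≤m)) ≇K₁,₃⁺
  from (inj₂ (inj₂ (inj₂ (inj₂ (e , 5≤m)))))     = contradiction (↪∧≥⇒≅ (↪-trans H↪F e) (grow 5≤m)) ≇2P₁⊕P₃

classify-induced : (G : Graph k) (subgraphs : (S : Subset k) → Forbidden (G [ S ]) ⊎ Allowed (G [ S ]) ⊎ Exceptional (G [ S ])) →
  (H : Graph n) → H ↪ G → ¬ (H ≅ K₁,₃) → ¬ (H ≅ K₁,₃⁺) → ¬ (H ≅ 2P₁⊕P₃) →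
  H ↪ graph G₂ → H ↪ graph G₃ → Allowed H
classify-induced G subgraphs H e ≇K₁,₃ ≇K₁,₃⁺ ≇2P₁⊕P₃ H↪G₂ H↪G₃ = classify (G [ image (_↪_.to e) ]) H
  (≅⇒↪ (G [ image (_↪_.to e) ]) H (↪⇒[]≅ e))
  (≅⇒↪ H (G [ image (_↪_.to e) ]) (≅-sym (G [ image (_↪_.to e) ]) H (↪⇒[]≅ e)))
  ≇K₁,₃ ≇K₁,₃⁺ ≇2P₁⊕P₃ H↪G₂ H↪G₃ (subgraphs (image (_↪_.to e)))

identical⇒Allowed : (H : Graph n) → ¬ (H ≅ K₁,₃) → ¬ (H ≅ K₁,₃⁺) → ¬ (H ≅ 2P₁⊕P₃) →
  IoctIdentical (Free3Colourable H) → Allowed H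
identical⇒Allowed H ≇K₁,₃ ≇K₁,₃⁺ ≇2P₁⊕P₃ identical =
  classify-induced (graph G₁) G₁-subgraphs H (counterexample-↪ H identical G₁) ≇K₁,₃ ≇K₁,₃⁺ ≇2P₁⊕P₃
    (counterexample-↪ H identical G₂) (counterexample-↪ H identical G₃)

-- Consequences of being allowed, and subgraphs of `P₄`

Allowed⇒Costless : (H : Graph m) → Allowed H → (G : Graph n) → Free H G → Colourable 3 G → Costless G
Allowed⇒Costless H allowed G free col = go allowed
  where
  avoids : {Q : Graph 4} → H ↪ Q → ¬ (Q ↪ G)
  avoids e q = Free⇒¬↪ H G free (↪-trans e q)

  go : Allowed H → Costless G
  go (here e)                         = 4P₁-free⇒Costless G col (avoids e)
  go (there (here e))                 = 2P₁⊕P₂-free⇒Costless G col (avoids e)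
  go (there (there (here e)))         = P₁⊕P₃-free⇒Costless G col (avoids e)
  go (there (there (there (here e)))) = P₄-free⇒Costless G col (avoids e)

-- The vertices of the four graphs are numbered so that the identity works.
allowed⊑P₄ : All (_⊑ path 4) allowed
allowed⊑P₄ = toWitness {a? = All.all? (λ Q → all? λ u → all? λ v → T? (adj Q u v) →-dec T? (adj (path 4) u v)) allowed} tt

2P₂↪̸allowed : All (λ Q → ¬ (2 · path 2 ↪ Q)) allowed
2P₂↪̸allowed = toWitness {a? = All.all? (λ Q → ¬? (2 · path 2 ↪? Q)) allowed} tt

Allowed⇒⊆P₄ : (H : Graph n) → Allowed H → H ⊆ᴳ path 4
Allowed⇒⊆P₄ H H-allowed with find H-allowed
... | Q , Q∈ , e = S , Q [ S ] , (λ u v → All.lookup allowed⊑P₄ Q∈ _ _) , ≅-sym (Q [ S ]) H (↪⇒[]≅ e)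
  where S = image (_↪_.to e)

Allowed⇒≇2P₂ : (H : Graph n) → Allowed H → ¬ (H ≅ 2 · path 2)
Allowed⇒≇2P₂ H H-allowed iso with find H-allowed
... | Q , Q∈ , e = All.lookup 2P₂↪̸allowed Q∈ (↪-trans (≅⇒↪ (2 · path 2) H (≅-sym H (2 · path 2) iso)) e)

⊆P₄⇒Allowed : (H : Graph n) → H ⊆ᴳ path 4 → ¬ (H ≅ 2 · path 2) → Allowed H
⊆P₄⇒Allowed {n} H (S , F , F⊑ , H≅F) ≇2P₂ = fromEdges _ _ _ refl refl refl
  where
  open _↪_ (≅⇒↪ H F H≅F) renaming (to to φ; injective to φ-injective; adj-≡ to φ-adj)

  g : Fin n → Fin 4
  g = elements S ∘ φ

  g-injective : ∀ {u v} → g u ≡ g v → u ≡ v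
  g-injective = φ-injective ∘ elements-injective S

  Edge : Fin 4 → Fin 4 → Set
  Edge x y = ∃[ u ] ∃[ v ] (g u ≡ x × g v ≡ y × Adj H u v)

  edge? : ∀ x y → Dec (Edge x y)
  edge? x y = any? λ u → any? λ v → g u ≟ x ×-dec (g v ≟ y ×-dec T? (adj H u v))

  Edge⇒path : ∀ {x y} → Edge x y → Adj (path 4) x y
  Edge⇒path (u , v , refl , refl , uv) = F⊑ _ _ (subst T (φ-adj u v) uv)

  Edge-sym : ∀ {x y} → Edge x y → Edge y x
  Edge-sym (u , v , gu , gv , uv) = v , u , gv , gu , Adj-sym H uv

  Q : Graph 4
  Q = record
    { adj    = λ x y → does (edge? x y)
    ; symm   = λ x y → does-⇔ (mk⇔ Edge-sym Edge-sym) (edge? x y) (edge? y x)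
    ; irrefl = λ x → dec-false (edge? x x) (Adj-irrefl (path 4) {x} ∘ Edge⇒path)
    }

  H↪Q : H ↪ Q
  H↪Q = embedding g g-injective λ u v → does-⇔ (mk⇔ (λ uv → u , v , refl , refl , uv)
    (λ (u′ , v′ , gu , gv , uv) → subst₂ (Adj H) (g-injective gu) (g-injective gv) uv))
    (T? (adj H u v)) (edge? (g u) (g v))

  absent : ∀ x y → ¬ Adj (path 4) x y → adj Q x y ≡ false
  absent x y ¬xy = dec-false (edge? x y) (¬xy ∘ Edge⇒path)

  q02 = absent 0F 2F id
  q03 = absent 0F 3F id
  q13 = absent 1F 3F id

  spanned : Edge 0F 1F → Edge 2F 3F → 4 ≤ n
  spanned (u₀ , u₁ , g₀ , g₁ , _) (u₂ , u₃ , g₂ , g₃ , _) =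
    injective⇒≤ {f = f} λ {x} {y} eq → trans (sym (g∘f x)) (trans (cong g eq) (g∘f y))
    where
    f : Fin 4 → Fin n
    f 0F = u₀
    f 1F = u₁
    f 2F = u₂
    f 3F = u₃

    g∘f : ∀ x → g (f x) ≡ x
    g∘f 0F = g₀
    g∘f 1F = g₁
    g∘f 2F = g₂
    g∘f 3F = g₃

  fromEdges : ∀ a b c → adj Q 0F 1F ≡ a → adj Q 1F 2F ≡ b → adj Q 2F 3F ≡ c → Allowed H
  fromEdges false false false q01 q12 q23 = here (↪-trans H↪Q
    (embed₄ Q 4P₁ {0F} {1F} {2F} {3F} (λ ()) (λ ()) (λ ()) (λ ()) (λ ()) (λ ()) q01 q02 q03 q12 q13 q23))
  fromEdges true false false q01 q12 q23 = there (here (↪-trans H↪Q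
    (embed₄ Q 2P₁⊕P₂ {2F} {3F} {0F} {1F} (λ ()) (λ ()) (λ ()) (λ ()) (λ ()) (λ ()) q01 q02 q03 q12 q13 q23)))
  fromEdges false true false q01 q12 q23 = there (here (↪-trans H↪Q
    (embed₄ Q 2P₁⊕P₂ {0F} {2F} {3F} {1F} (λ ()) (λ ()) (λ ()) (λ ()) (λ ()) (λ ()) q01 q02 q03 q12 q13 q23)))
  fromEdges false false true q01 q12 q23 = there (here (↪-trans H↪Q
    (embed₄ Q 2P₁⊕P₂ {0F} {1F} {2F} {3F} (λ ()) (λ ()) (λ ()) (λ ()) (λ ()) (λ ()) q01 q02 q03 q12 q13 q23)))
  fromEdges true true false q01 q12 q23 = there (there (here (↪-trans H↪Q
    (embed₄ Q P₁⊕P₃ {1F} {2F} {3F} {0F} (λ ()) (λ ()) (λ ()) (λ ()) (λ ()) (λ ()) q01 q02 q03 q12 q13 q23))))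
  fromEdges false true true q01 q12 q23 = there (there (here (↪-trans H↪Q
    (embed₄ Q P₁⊕P₃ {0F} {1F} {2F} {3F} (λ ()) (λ ()) (λ ()) (λ ()) (λ ()) (λ ()) q01 q02 q03 q12 q13 q23))))
  fromEdges true true true q01 q12 q23 = there (there (there (here (↪-trans H↪Q
    (embed₄ Q P₄ {0F} {1F} {2F} {3F} (λ ()) (λ ()) (λ ()) (λ ()) (λ ()) (λ ()) q01 q02 q03 q12 q13 q23)))))
  -- Here Q is `2P₂`, and both of its edges come from H, so H has all four vertices.
  fromEdges true false true q01 q12 q23 = contradiction
    (↪∧≥⇒≅ (↪-trans H↪Q (embed₄ Q (2 · path 2) {0F} {1F} {2F} {3F}
      (λ ()) (λ ()) (λ ()) (λ ()) (λ ()) (λ ()) q01 q02 q03 q12 q13 q23))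
      (spanned (does⇒ (edge? 0F 1F) q01) (does⇒ (edge? 2F 3F) q23)))
    ≇2P₂

theorem6 : ∀ {n : ℕ} (H : Graph n) →
    ¬ (H ≅ K₁,₃) → ¬ (H ≅ K₁,₃⁺) → ¬ (H ≅ 2 · path 1 ⊕ path 3) →
    IoctIdentical (Free3Colourable H) ⇔ (H ⊆ᴳ path 4 × ¬ (H ≅ 2 · path 2))
theorem6 H ≇K₁,₃ ≇K₁,₃⁺ ≇2P₁⊕P₃ = mk⇔ {A = IoctIdentical (Free3Colourable H)}
  (λ identical → let ok = identical⇒Allowed H ≇K₁,₃ ≇K₁,₃⁺ ≇2P₁⊕P₃ identical in
    Allowed⇒⊆P₄ H ok , Allowed⇒≇2P₂ H ok)
  (λ (H⊆P₄ , ≇2P₂) G (free , col) → Costless⇒ioct≡oct G col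
    (Allowed⇒Costless H (⊆P₄⇒Allowed H H⊆P₄ ≇2P₂) G free col))
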